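{- For $k\geq0$ let $(\mathfrak{S}\mathit{Sym})^k$ be the subspace of $\mathfrak{S}\mathit{Sym}$ spanned by $\{\mathcal{M}_u\mid u\in\mathfrak{S}^k\}$, where $\mathfrak{S}^0=\mathfrak{S}_0$ and, for $k\geq1$, $\mathfrak{S}^k$ is the set of permutations $u\in\mathfrak{S}_n$, $n\geq1$, having exactly $k-1$ global descents. Then the decomposition $\mathfrak{S}\mathit{Sym}=\bigoplus_{k\geq0}(\mathfrak{S}\mathit{Sym})^k$ is a coalgebra grading, and, endowed with this grading, $\mathfrak{S}\mathit{Sym}$ is a cofree graded coalgebra.
   Context: $\mathfrak{S}_n$ is the symmetric group on $[n]$ ($\mathfrak{S}_0$ has one element); $u$ is written as the word $u_1\cdots u_n$; permutations multiply as functions. $\ell(u)=\#\{i<j\mid u_i>u_j\}$; weak order: $u\leq v$ iff $v=wu$ with $\ell(v)=\ell(w)+\ell(u)$. A global descent of $u\in\mathfrak{S}_n$ is $p\in[n-1]$ with $u_i>u_j$ whenever $i\leq p<j$. For distinct integers $a_1,\dots,a_p$, $\mathrm{st}(a_1,\dots,a_p)\in\mathfrak{S}_p$ is the permutation $u$ with $u_i<u_j\iff a_i<a_j$; $u\times v\in\mathfrak{S}_{p+q}$ has word $u_1\cdots u_p(v_1+p)\cdots(v_q+p)$; $\mathfrak{S}^{(p,q)}$ is the set of $\zeta\in\mathfrak{S}_{p+q}$ with no descent except possibly at $p$. $\mathfrak{S}\mathit{Sym}$ is the graded $\mathbb{Q}$-vector space with basis $\{\mathcal{F}_u\mid u\in\mathfrak{S}_n,n\geq0\}$,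 product $\mathcal{F}_u\cdot\mathcal{F}_v=\sum_{\zeta\in\mathfrak{S}^{(p,q)}}\mathcal{F}_{(u\times v)\zeta^{ -1}}$, coproduct $\Delta(\mathcal{F}_u)=\sum_{p=0}^n\mathcal{F}_{\mathrm{st}(u_1,\dots,u_p)}\otimes\mathcal{F}_{\mathrm{st}(u_{p+1},\dots,u_n)}$ and counit $\epsilon(\mathcal{F}_u)=0$ for $n\geq1$, $\epsilon(\mathcal{F}_\emptyset)=1$ (a graded connected Hopf algebra). The monomial basis is $\mathcal{M}_u=\sum_{v\geq u}\mu_{\mathfrak{S}_n}(u,v)\mathcal{F}_v$, $\mu_{\mathfrak{S}_n}$ the Möbius function of the weak order. A decomposition $C=\bigoplus_{k\geq0}C^k$ of a coalgebra is a coalgebra grading if $\Delta(C^k)\subseteq\sum_{i+j=k}C^i\otimes C^j$ and $\epsilon(C^k)=0$ for $k\neq0$. For a vector space $V$, $Q(V)=\bigoplus_{k\geq0}V^{\otimes k}$ is the graded coalgebra with deconcatenation coproduct $\Delta(v_1\otimes\cdots\otimes v_k)=\sum_{i=0}^k(v_1\otimes\cdots\otimes v_i)\otimes(v_{i+1}\otimes\cdots\otimes v_k)$ and counit vanishing on $V^{\otimes k}$, $k\geq1$; a graded coalgebra is cofree if it is isomorphic as a graded coalgebra to $Q(V)$ for some $V$. -}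

module Defs where

open import Data.Bool using (Bool; true; false; T; _∧_; if_then_else_; not)
open import Data.Nat as ℕ using (ℕ; zero; suc)
open import Data.Fin using (Fin)
import Data.Fin
open import Data.List using (List; []; _∷_; _++_; map; concatMap; length; filter; take; drop; upTo; mapMaybe; sum)
import Data.List.Properties as LP
open import Data.Bool.ListAction using (all; any)
open import Data.Maybe using (Maybe; just; nothing)
open import Data.Product using (Σ; _×_; _,_; proj₁; proj₂)
import Data.Product.Properties as PP
open import Data.Rational as ℚ using (ℚ; 0ℚ; 1ℚ)
open import Relation.Binary.Definitions using (DecidableEquality)
open import Relation.Binary.PropositionalEquality using (_≡_; refl)
open import Relation.Nullary using (yes; no; ⌊_⌋)
open import Relation.Nullary.Decidable using (T?)

-- Free ℚ-vector spaces: finite formal linear combinations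
-- Σ qᵢ · aᵢ of basis elements of a type A, with equality
-- "same coefficient on every basis element".

FS : Set → Set
FS A = List (ℚ × A)

coeff : {A : Set} → DecidableEquality A → FS A → A → ℚ
coeff _≟_ [] a = 0ℚ
coeff _≟_ ((q , b) ∷ xs) a with b ≟ a
... | yes _ = q ℚ.+ coeff _≟_ xs a
... | no  _ = coeff _≟_ xs a

Eqv : {A : Set} → DecidableEquality A → FS A → FS A → Set
Eqv d x y = ∀ a → coeff d x a ≡ coeff d y a

bas : {A : Set} → A → FS A
bas a = (1ℚ , a) ∷ []

_·_ : {A : Set} → ℚ → FS A → FS A
q · x = map (λ p → (q ℚ.* proj₁ p , proj₂ p)) x

lin : {A B : Set} → (A → FS B) → FS A → FS B
lin f x = concatMap (λ p → proj₁ p · f (proj₂ p)) x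

linℚ : {A : Set} → (A → ℚ) → FS A → ℚ
linℚ f [] = 0ℚ
linℚ f ((q , a) ∷ xs) = q ℚ.* f a ℚ.+ linℚ f xs

sumV : {A : Set} (N : ℕ) → (Fin N → FS A) → FS A
sumV zero    xs = []
sumV (suc N) xs = xs Data.Fin.zero ++ sumV N (λ i → xs (Data.Fin.suc i))

_⊗_ : {A B : Set} → FS A → FS B → FS (A × B)
x ⊗ y = concatMap (λ p → map (λ r → (proj₁ p ℚ.* proj₁ r , (proj₂ p , proj₂ r))) y) x

Span : {A I : Set} → DecidableEquality A → (I → FS A) → FS A → Set
Span {A} {I} d g x = Σ (FS I) λ c → Eqv d x (lin g c)

×-dec : {A B : Set} → DecidableEquality A → DecidableEquality B → DecidableEquality (A × B)
×-dec dA dB = PP.≡-dec dA dB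

range1 : ℕ → List ℕ
range1 n = map suc (upTo n)

-- a word of length n containing each of 1..n is a permutation of [n]
isPermᵇ : List ℕ → Bool
isPermᵇ w = all (λ i → any (λ x → x ℕ.≡ᵇ i) w) (range1 (length w))

record Perm : Set where
  constructor perm
  field
    word : List ℕ
    .isPerm : T (isPermᵇ word)
open Perm public

size : Perm → ℕ
size u = length (word u)

perm-≟ : DecidableEquality Perm
perm-≟ (perm w p) (perm v q) with LP.≡-dec ℕ._≟_ w v
... | yes refl = yes refl
... | no ne = no (λ { refl → ne refl })

mkPerm? : List ℕ → Maybe Perm
mkPerm? w with T? (isPermᵇ w)
... | yes p = just (perm w p)
... | no  _ = nothing

-- totalised: returns the empty permutation on non-permutation words
-- (only ever applied to words which are permutations)
toPerm : List ℕ → Perm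
toPerm w with mkPerm? w
... | just u  = u
... | nothing = perm [] _

insertAll : ℕ → List ℕ → List (List ℕ)
insertAll x [] = (x ∷ []) ∷ []
insertAll x (y ∷ ys) = (x ∷ y ∷ ys) ∷ map (y ∷_) (insertAll x ys)

permWords : ℕ → List (List ℕ)
permWords zero = [] ∷ []
permWords (suc n) = concatMap (insertAll (suc n)) (permWords n)

allPerms : ℕ → List Perm
allPerms n = mapMaybe mkPerm? (permWords n)

-- value w(i), 1-indexed
at : List ℕ → ℕ → ℕ
at [] i = 0
at (x ∷ xs) zero = 0
at (x ∷ xs) (suc zero) = x
at (x ∷ xs) (suc (suc i)) = at xs (suc i)

-- word of the composite w ∘ u (permutations multiply as functions)
compose : List ℕ → List ℕ → List ℕ
compose w u = map (at w) u

invW : List ℕ → ℕ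
invW [] = 0
invW (x ∷ xs) = length (filter (λ y → y ℕ.<? x) xs) ℕ.+ invW xs

ℓ : Perm → ℕ
ℓ u = invW (word u)

eqWᵇ : List ℕ → List ℕ → Bool
eqWᵇ w v = ⌊ LP.≡-dec ℕ._≟_ w v ⌋

weakLeᵇ : Perm → Perm → Bool
weakLeᵇ u v = (size u ℕ.≡ᵇ size v) ∧
  any (λ w → eqWᵇ (compose (word w) (word u)) (word v) ∧ (ℓ v ℕ.≡ᵇ (ℓ w ℕ.+ ℓ u)))
      (allPerms (size u))

sumℚ : List ℚ → ℚ
sumℚ [] = 0ℚ
sumℚ (q ∷ qs) = q ℚ.+ sumℚ qs

-- Möbius function of the weak order, μ(u,u) = 1,
-- μ(u,v) = - Σ_{u ≤ w < v} μ(u,w) for u < v, μ(u,v) = 0 otherwise.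
-- Computed with fuel; fuel ℓ(v) - ℓ(u) + 1 suffices.
möbF : ℕ → Perm → Perm → ℚ
möbF zero u v = 0ℚ
möbF (suc f) u v =
  if eqWᵇ (word u) (word v) then 1ℚ
  else if weakLeᵇ u v
       then ℚ.- sumℚ (map (λ w → möbF f u w)
                       (filter (λ w → T? (weakLeᵇ u w ∧ weakLeᵇ w v ∧ not (eqWᵇ (word w) (word v))))
                               (allPerms (size v))))
       else 0ℚ

μ : Perm → Perm → ℚ
μ u v = möbF (suc (ℓ v ℕ.∸ ℓ u)) u v

-- 𝔖Sym as a coalgebra, in the fundamental basis F_u (= bas u)

SSym : Set
SSym = FS Perm

_≈_ : SSym → SSym → Set
_≈_ = Eqv perm-≟

_≈₂_ : FS (Perm × Perm) → FS (Perm × Perm) → Set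
_≈₂_ = Eqv (×-dec perm-≟ perm-≟)

stW : List ℕ → List ℕ
stW w = map (λ a → suc (length (filter (λ b → b ℕ.<? a) w))) w

st : List ℕ → Perm
st w = toPerm (stW w)

ΔF : Perm → FS (Perm × Perm)
ΔF u = map (λ p → (1ℚ , (st (take p (word u)) , st (drop p (word u)))))
           (upTo (suc (size u)))

Δ : SSym → FS (Perm × Perm)
Δ = lin ΔF

εF : Perm → ℚ
εF u with size u
... | zero  = 1ℚ
... | suc _ = 0ℚ

ε : SSym → ℚ
ε = linℚ εF

M : Perm → SSym
M u = map (λ v → (μ u v , v)) (filter (λ v → T? (weakLeᵇ u v)) (allPerms (size u)))

isGlobalDescᵇ : List ℕ → ℕ → Bool
isGlobalDescᵇ w p = all (λ a → all (λ b → b ℕ.<ᵇ a) (drop p w)) (take p w)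

numGlobalDesc : Perm → ℕ
numGlobalDesc u =
  length (filter (λ p → T? (isGlobalDescᵇ (word u) p)) (range1 (size u ℕ.∸ 1)))

inSᵏ : ℕ → Perm → Bool
inSᵏ zero u = size u ℕ.≡ᵇ 0
inSᵏ (suc k) u = not (size u ℕ.≡ᵇ 0) ∧ (numGlobalDesc u ℕ.≡ᵇ k)

SSymᵏ : ℕ → SSym → Set
SSymᵏ k = Span {I = Σ Perm (λ u → T (inSᵏ k u))} perm-≟ (λ i → M (proj₁ i))

SSym⊗ᵏ : ℕ → FS (Perm × Perm) → Set
SSym⊗ᵏ k = Span
  {I = Σ ℕ λ i → Σ ℕ λ j → (i ℕ.+ j ≡ k) × Σ SSym (SSymᵏ i) × Σ SSym (SSymᵏ j)}
  (×-dec perm-≟ perm-≟) (λ t → proj₁ (proj₁ (proj₂ (proj₂ (proj₂ t)))) ⊗ proj₁ (proj₂ (proj₂ (proj₂ (proj₂ t)))))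

IsDecomposition : (ℕ → SSym → Set) → Set
IsDecomposition C =
  (∀ (x : SSym) → Σ ℕ λ N → Σ (Fin N → SSym) λ xs →
       (∀ k → C (Data.Fin.toℕ k) (xs k)) × (x ≈ sumV N xs))
  × (∀ (N : ℕ) (xs : Fin N → SSym) → (∀ k → C (Data.Fin.toℕ k) (xs k)) →
       sumV N xs ≈ [] → ∀ k → xs k ≈ [])

IsCoalgebraGrading : (ℕ → SSym → Set) → (ℕ → FS (Perm × Perm) → Set) → Set
IsCoalgebraGrading C C⊗ =
  (∀ k x → C k x → C⊗ k (Δ x)) × (∀ k x → C (suc k) x → ε x ≡ 0ℚ)

-- The cofree coalgebra Q(V) for V the ℚ-vector space with basis B:
-- V^{⊗k} has basis the words of length k in B, so Q(V) = FS (List B),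
-- with deconcatenation coproduct.

module Cofree (B : Set) (_≟B_ : DecidableEquality B) where

  QV : Set
  QV = FS (List B)

  decW : DecidableEquality (List B)
  decW = LP.≡-dec _≟B_

  _≈Q_ : QV → QV → Set
  _≈Q_ = Eqv decW

  _≈Q₂_ : FS (List B × List B) → FS (List B × List B) → Set
  _≈Q₂_ = Eqv (×-dec decW decW)

  ΔQ : QV → FS (List B × List B)
  ΔQ = lin (λ w → map (λ i → (1ℚ , (take i w , drop i w))) (upTo (suc (length w))))

  εQ : QV → ℚ
  εQ = linℚ (λ w → if length w ℕ.≡ᵇ 0 then 1ℚ else 0ℚ)

  Qᵏ : ℕ → QV → Set
  Qᵏ k = Span {I = Σ (List B) (λ w → length w ≡ k)} decW (λ i → bas (proj₁ i))

  IsGradedCoalgIso : (ℕ → SSym → Set) → (Perm → QV) → (List B → SSym) → Set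
  IsGradedCoalgIso C φ ψ =
    (∀ x → lin ψ (lin φ x) ≈ x) ×
    (∀ y → lin φ (lin ψ y) ≈Q y) ×
    (∀ x → ΔQ (lin φ x) ≈Q₂ lin (λ p → φ (proj₁ p) ⊗ φ (proj₂ p)) (Δ x)) ×
    (∀ x → εQ (lin φ x) ≡ ε x) ×
    (∀ k x → C k x → Qᵏ k (lin φ x)) ×
    (∀ k y → Qᵏ k y → C k (lin ψ y))

IsCofree : (ℕ → SSym → Set) → Set₁
IsCofree C = Σ Set λ B → Σ (DecidableEquality B) λ d →
  Σ (Perm → FS (List B)) λ φ → Σ (List B → SSym) λ ψ →
    Cofree.IsGradedCoalgIso B d C φ ψ

-- Write a ⊹ b for the permutation whose word is that of a, shifted above the letters of b, followed by
-- that of b.  The weak order is inclusion of inversion sets, and all pairs across the boundary are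
-- inversions of a ⊹ b; hence u ≤ a ⊹ b iff st(u₁ … u_p) ≤ a and st(u_{p+1} … u_n) ≤ b, where p = |a| and
-- n = |a| + |b|.  Since F_u is the sum of the M_v with v ≥ u (Möbius inversion), comparing the
-- coefficients of M_a ⊗ M_b in Δ F_u shows that Δ M_v is the sum of M_a ⊗ M_b over all factorisations
-- v = a ⊹ b.  Under ⊹ the permutations form the free monoid on the nonempty permutations without global
-- descents, and k - 1 global descents mean k factors, so in the monomial basis Δ is deconcatenation of
-- words in these generators, graded by length.
module Submission where

open import Defs
open import Data.Bool using (Bool; true; false; T; _∧_; not; if_then_else_)
open import Data.Bool.Properties using (T-∧; T-≡; T-irrelevant; ¬-not)
open import Data.Fin using (Fin; toℕ; fromℕ<)
import Data.Fin as Fin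
open import Data.Fin.Properties using (toℕ-fromℕ<; toℕ-injective)
open import Data.List using (List; []; _∷_; _++_; map; filter; length; take; drop; applyUpTo; upTo;
  mapMaybe; deduplicate)
open import Data.List.Membership.Propositional using (_∈_; _∉_; find)
open import Data.List.Membership.Propositional.Properties
  using (∈-map⁺; ∈-map⁻; ∈-++⁺ˡ; ∈-++⁺ʳ; ∈-++⁻; ∈-∃++; ∈-concatMap⁺; ∈-concatMap⁻;
         ∈-filter⁺; ∈-filter⁻; ∈-upTo⁺; ∈-upTo⁻; ∈-deduplicate⁺)
import Data.List.Properties as List
open import Data.List.Relation.Binary.Disjoint.Propositional using (Disjoint)
import Data.List.Relation.Binary.Permutation.Propositional as ↭
open ↭ using (_↭_; prep; swap; ↭-sym; ↭-trans; ↭-refl; ↭-reflexive; ↭⇒↭ₛ)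
open import Data.List.Relation.Binary.Permutation.Propositional.Properties
  using (↭-length; filter-↭; ∈-resp-↭; drop-∷; drop-mid; shift) renaming (map⁺ to ↭-map⁺)
import Data.List.Relation.Binary.Permutation.Setoid.Properties as ↭ₛ
open import Data.List.Relation.Binary.Pointwise as Pointwise using (Pointwise; []; _∷_)
open import Data.List.Relation.Unary.All as All using (All; []; _∷_)
import Data.List.Relation.Unary.All.Properties as All
open import Data.List.Relation.Unary.AllPairs as AllPairs using (AllPairs; []; _∷_)
import Data.List.Relation.Unary.AllPairs.Properties as AllPairs
open import Data.List.Relation.Unary.Any as Any using (here; there)
import Data.List.Relation.Unary.Any.Properties as Any
open import Data.List.Relation.Unary.Unique.DecPropositional.Properties using (deduplicate-!)
open import Data.List.Relation.Unary.Unique.Propositional using (Unique)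
import Data.List.Relation.Unary.Unique.Propositional.Properties as Unique
open import Data.Maybe using (just; nothing)
open import Data.Nat as ℕ using (ℕ; zero; suc; _+_; _∸_; _⊔_; _≤_; _<_; z≤n; s≤s; _<?_; _<ᵇ_)
open import Data.Nat.ListAction using (sum)
import Data.Nat.Properties as ℕ
open import Data.Nat.Solver using () renaming (module +-*-Solver to ℕ-Solver)
open import Data.Product using (Σ; _×_; _,_; proj₁; proj₂; ∃)
open import Data.Product.Properties using (,-injectiveˡ; ,-injectiveʳ)
open import Data.Rational as ℚ using (ℚ; 0ℚ; 1ℚ)
import Data.Rational.Properties as ℚ
open import Data.Rational.Solver using () renaming (module +-*-Solver to ℚ-Solver)
open import Data.Sum using (_⊎_; inj₁; inj₂; [_,_]′)
open import Function using (_∘_; id; case_of_)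
open import Function.Bundles using (Equivalence)
open import Relation.Binary.Bundles using (Setoid)
open import Relation.Binary.Definitions using (DecidableEquality; tri<; tri≈; tri>)
open import Relation.Binary.PropositionalEquality
import Relation.Binary.Reasoning.Setoid as SetoidReasoning
open import Relation.Nullary using (yes; no; ¬_; Dec; does; contradiction; ¬?)
open import Relation.Nullary.Decidable
  using (T?; recompute; map′; toWitness; fromWitness; toWitnessFalse; fromWitnessFalse; dec-true; dec-false)

-- Comparing coefficients in the coproduct is easy because at most one term survives on either side.
-- In Δ F_u the size of `a` dictates where the word of u is cut; in the deconcatenation of v the
-- number of factors of `a` dictates it. All these coefficients are 0 or 1, so the comparison is
-- made on the expansions of the F_u, and μ enters only in showing that `M` and `G` are mutually
-- inverse. That the weak order is inclusion of inversion sets rests on a count: ℓ(wu) falls short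
-- of ℓ(w) + ℓ(u) by twice the number of inversions of u that w undoes, so equality of lengths means
-- that none is undone.

private variable
  A A′ B B′ C : Set

-- Finite sums and linear functionals

⟦_⟧ : Bool → ℚ
⟦ b ⟧ = if b then 1ℚ else 0ℚ

⟦∧⟧ : ∀ b c → ⟦ b ∧ c ⟧ ≡ ⟦ b ⟧ ℚ.* ⟦ c ⟧
⟦∧⟧ true  c = sym (ℚ.*-identityˡ ⟦ c ⟧)
⟦∧⟧ false c = sym (ℚ.*-zeroˡ ⟦ c ⟧)

∑ : List A → (A → ℚ) → ℚ
∑ xs f = sumℚ (map f xs)

∑-cong-∈ : ∀ (xs : List A) {f g : A → ℚ} → (∀ {a} → a ∈ xs → f a ≡ g a) → ∑ xs f ≡ ∑ xs g
∑-cong-∈ []       e = refl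
∑-cong-∈ (x ∷ xs) e = cong₂ ℚ._+_ (e (here refl)) (∑-cong-∈ xs (e ∘ there))

∑-cong : ∀ (xs : List A) {f g : A → ℚ} → (∀ a → f a ≡ g a) → ∑ xs f ≡ ∑ xs g
∑-cong xs e = ∑-cong-∈ xs (λ {a} _ → e a)

∑-zero : ∀ (xs : List A) {f : A → ℚ} → (∀ {a} → a ∈ xs → f a ≡ 0ℚ) → ∑ xs f ≡ 0ℚ
∑-zero []       e = refl
∑-zero (x ∷ xs) e = cong₂ ℚ._+_ (e (here refl)) (∑-zero xs (e ∘ there))

∑-+ : ∀ (xs : List A) (f g : A → ℚ) → ∑ xs (λ a → f a ℚ.+ g a) ≡ ∑ xs f ℚ.+ ∑ xs g
∑-+ []       f g = refl
∑-+ (x ∷ xs) f g = trans (cong (f x ℚ.+ g x ℚ.+_) (∑-+ xs f g))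
  (solve 4 (λ a b c d → (a :+ b) :+ (c :+ d) := (a :+ c) :+ (b :+ d)) refl (f x) (g x) (∑ xs f) (∑ xs g))
  where open ℚ-Solver

∑-*ˡ : ∀ (xs : List A) (q : ℚ) (f : A → ℚ) → ∑ xs (λ a → q ℚ.* f a) ≡ q ℚ.* ∑ xs f
∑-*ˡ []       q f = sym (ℚ.*-zeroʳ q)
∑-*ˡ (x ∷ xs) q f = trans (cong (q ℚ.* f x ℚ.+_) (∑-*ˡ xs q f)) (sym (ℚ.*-distribˡ-+ q (f x) (∑ xs f)))

∑-*ʳ : ∀ (xs : List A) (q : ℚ) (f : A → ℚ) → ∑ xs (λ a → f a ℚ.* q) ≡ ∑ xs f ℚ.* q
∑-*ʳ xs q f = trans (∑-cong xs (λ a → ℚ.*-comm (f a) q)) (trans (∑-*ˡ xs q f) (ℚ.*-comm q _))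

∑-swap : ∀ (xs : List A) (ys : List B) (h : A → B → ℚ) →
  ∑ xs (λ a → ∑ ys (h a)) ≡ ∑ ys (λ b → ∑ xs (λ a → h a b))
∑-swap []       ys h = sym (∑-zero ys (λ _ → refl))
∑-swap (x ∷ xs) ys h = trans (cong (∑ ys (h x) ℚ.+_) (∑-swap xs ys h))
  (sym (∑-+ ys (h x) (λ b → ∑ xs (λ a → h a b))))

∑-map : ∀ (g : B → A) (xs : List B) (f : A → ℚ) → ∑ (map g xs) f ≡ ∑ xs (f ∘ g)
∑-map g []       f = refl
∑-map g (x ∷ xs) f = cong (f (g x) ℚ.+_) (∑-map g xs f)

∑-filter : ∀ (b : A → Bool) (xs : List A) (f : A → ℚ) →
  ∑ (filter (λ a → T? (b a)) xs) f ≡ ∑ xs (λ a → ⟦ b a ⟧ ℚ.* f a)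
∑-filter b []       f = refl
∑-filter b (x ∷ xs) f with b x
... | true  = cong₂ ℚ._+_ (sym (ℚ.*-identityˡ (f x))) (∑-filter b xs f)
... | false = trans (∑-filter b xs f) (sym (trans (cong (ℚ._+ _) (ℚ.*-zeroˡ (f x))) (ℚ.+-identityˡ _)))

-- The form in which all coefficients are computed below: uniqueness of the list guarantees that the
-- surviving term is counted once.
∑-single : ∀ {xs : List A} {a} (f : A → ℚ) → Unique xs → a ∈ xs →
  (∀ {x} → x ∈ xs → x ≢ a → f x ≡ 0ℚ) → ∑ xs f ≡ f a
∑-single {xs = x ∷ xs} f (px ∷ _) (here refl) z =
  trans (cong (f x ℚ.+_) (∑-zero xs (λ {y} y∈ → z (there y∈) (λ { refl → All.lookup px y∈ refl }))))
        (ℚ.+-identityʳ (f x))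
∑-single {xs = x ∷ xs} {a} f (px ∷ u) (there a∈) z =
  trans (cong₂ ℚ._+_ (z (here refl) (All.lookup px a∈)) (∑-single f u a∈ (z ∘ there)))
        (ℚ.+-identityˡ (f a))

linℚ-∑ : ∀ (f : A → ℚ) x → linℚ f x ≡ ∑ x (λ p → proj₁ p ℚ.* f (proj₂ p))
linℚ-∑ f []            = refl
linℚ-∑ f ((q , a) ∷ x) = cong (q ℚ.* f a ℚ.+_) (linℚ-∑ f x)

linℚ-cong-∈ : ∀ {f g : A → ℚ} x → (∀ {p} → p ∈ x → f (proj₂ p) ≡ g (proj₂ p)) → linℚ f x ≡ linℚ g x
linℚ-cong-∈ []            e = refl
linℚ-cong-∈ ((q , a) ∷ x) e = cong₂ (λ s t → q ℚ.* s ℚ.+ t) (e (here refl)) (linℚ-cong-∈ x (e ∘ there))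

linℚ-cong : ∀ {f g : A → ℚ} x → (∀ a → f a ≡ g a) → linℚ f x ≡ linℚ g x
linℚ-cong x e = linℚ-cong-∈ x (λ {p} _ → e (proj₂ p))

linℚ-zero : ∀ (x : FS A) → linℚ (λ _ → 0ℚ) x ≡ 0ℚ
linℚ-zero x = trans (linℚ-∑ (λ _ → 0ℚ) x) (∑-zero x (λ {p} _ → ℚ.*-zeroʳ (proj₁ p)))

linℚ-*ˡ : ∀ q (f : A → ℚ) x → linℚ (λ a → q ℚ.* f a) x ≡ q ℚ.* linℚ f x
linℚ-*ˡ q f []            = sym (ℚ.*-zeroʳ q)
linℚ-*ˡ q f ((r , a) ∷ x) = trans (cong (r ℚ.* (q ℚ.* f a) ℚ.+_) (linℚ-*ˡ q f x))
  (solve 4 (λ q r a c → r :* (q :* a) :+ q :* c := q :* (r :* a :+ c)) refl q r (f a) (linℚ f x))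
  where open ℚ-Solver

linℚ-++ : ∀ (f : A → ℚ) x y → linℚ f (x ++ y) ≡ linℚ f x ℚ.+ linℚ f y
linℚ-++ f []            y = sym (ℚ.+-identityˡ _)
linℚ-++ f ((q , a) ∷ x) y = trans (cong (q ℚ.* f a ℚ.+_) (linℚ-++ f x y))
                                  (sym (ℚ.+-assoc (q ℚ.* f a) (linℚ f x) (linℚ f y)))

linℚ-· : ∀ (f : A → ℚ) q x → linℚ f (q · x) ≡ q ℚ.* linℚ f x
linℚ-· f q []            = sym (ℚ.*-zeroʳ q)
linℚ-· f q ((r , a) ∷ x) = trans (cong (q ℚ.* r ℚ.* f a ℚ.+_) (linℚ-· f q x))
  (solve 4 (λ q r a c → q :* r :* a :+ q :* c := q :* (r :* a :+ c)) refl q r (f a) (linℚ f x))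
  where open ℚ-Solver

linℚ-bas : ∀ (f : A → ℚ) a → linℚ f (bas a) ≡ f a
linℚ-bas f a = trans (ℚ.+-identityʳ _) (ℚ.*-identityˡ (f a))

linℚ-lin : ∀ (f : B → ℚ) (g : A → FS B) x → linℚ f (lin g x) ≡ linℚ (λ a → linℚ f (g a)) x
linℚ-lin f g []            = refl
linℚ-lin f g ((q , a) ∷ x) = trans (linℚ-++ f (q · g a) (lin g x))
                                   (cong₂ ℚ._+_ (linℚ-· f q (g a)) (linℚ-lin f g x))

linℚ-⊗ : ∀ (f : A × B → ℚ) x y → linℚ f (x ⊗ y) ≡ linℚ (λ a → linℚ (λ b → f (a , b)) y) x
linℚ-⊗ f []            y = refl
linℚ-⊗ {A} {B} f ((q , a) ∷ x) y = trans (linℚ-++ f (map _ y) (x ⊗ y))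
                                 (cong₂ ℚ._+_ (head y) (linℚ-⊗ f x y))
  where
  open ℚ-Solver
  head : ∀ y → linℚ f (map (λ r → (q ℚ.* proj₁ r , (a , proj₂ r))) y) ≡ q ℚ.* linℚ (λ b → f (a , b)) y
  head []            = sym (ℚ.*-zeroʳ q)
  head ((r , b) ∷ y) = trans (cong (q ℚ.* r ℚ.* f (a , b) ℚ.+_) (head y))
    (solve 4 (λ q r a c → q :* r :* a :+ q :* c := q :* (r :* a :+ c)) refl q r (f (a , b)) (linℚ (λ b → f (a , b)) y))

linℚ-⊗-* : ∀ (f : A → ℚ) (g : B → ℚ) x y →
  linℚ (λ p → f (proj₁ p) ℚ.* g (proj₂ p)) (x ⊗ y) ≡ linℚ f x ℚ.* linℚ g y
linℚ-⊗-* f g x y = let open ≡-Reasoning in begin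
  linℚ (λ p → f (proj₁ p) ℚ.* g (proj₂ p)) (x ⊗ y) ≡⟨ linℚ-⊗ _ x y ⟩
  linℚ (λ a → linℚ (λ b → f a ℚ.* g b) y) x        ≡⟨ linℚ-cong x (λ a → trans (linℚ-*ˡ (f a) g y) (ℚ.*-comm (f a) _)) ⟩
  linℚ (λ a → linℚ g y ℚ.* f a) x                  ≡⟨ linℚ-*ˡ (linℚ g y) f x ⟩
  linℚ g y ℚ.* linℚ f x                            ≡⟨ ℚ.*-comm (linℚ g y) (linℚ f x) ⟩
  linℚ f x ℚ.* linℚ g y                            ∎

linℚ-swap : ∀ (h : A → B → ℚ) x y →
  linℚ (λ a → linℚ (h a) y) x ≡ linℚ (λ b → linℚ (λ a → h a b) x) y
linℚ-swap h []            y = sym (linℚ-zero y)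
linℚ-swap h ((q , a) ∷ x) y = let open ≡-Reasoning in begin
  q ℚ.* linℚ (h a) y ℚ.+ linℚ (λ a → linℚ (h a) y) x
    ≡⟨ cong (q ℚ.* linℚ (h a) y ℚ.+_) (linℚ-swap h x y) ⟩
  q ℚ.* linℚ (h a) y ℚ.+ linℚ (λ b → linℚ (λ a → h a b) x) y
    ≡⟨ step y ⟩
  linℚ (λ b → q ℚ.* h a b ℚ.+ linℚ (λ a → h a b) x) y ∎
  where
  open ℚ-Solver
  step : ∀ y → q ℚ.* linℚ (h a) y ℚ.+ linℚ (λ b → linℚ (λ a → h a b) x) y
              ≡ linℚ (λ b → q ℚ.* h a b ℚ.+ linℚ (λ a → h a b) x) y
  step [] = trans (ℚ.+-identityʳ _) (ℚ.*-zeroʳ q)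
  step ((r , b) ∷ y) = trans
    (solve 6 (λ q r s t u v → q :* (r :* s :+ t) :+ (r :* u :+ v) := r :* (q :* s :+ u) :+ (q :* t :+ v)) refl
       q r (h a b) (linℚ (h a) y) (linℚ (λ a → h a b) x) (linℚ (λ b → linℚ (λ a → h a b) x) y))
    (cong (r ℚ.* (q ℚ.* h a b ℚ.+ linℚ (λ a → h a b) x) ℚ.+_) (step y))

linℚ-weighted : ∀ (f : B → ℚ) (c : A → ℚ) (g : A → B) xs →
  linℚ f (map (λ a → (c a , g a)) xs) ≡ ∑ xs (λ a → c a ℚ.* f (g a))
linℚ-weighted f c g xs = trans (linℚ-∑ f (map (λ a → (c a , g a)) xs))
  (∑-map (λ a → (c a , g a)) xs (λ p → proj₁ p ℚ.* f (proj₂ p)))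

linℚ-unweighted : ∀ (f : B → ℚ) (g : A → B) xs →
  linℚ f (map (λ a → (1ℚ , g a)) xs) ≡ ∑ xs (f ∘ g)
linℚ-unweighted f g xs = trans (linℚ-weighted f (λ _ → 1ℚ) g xs) (∑-cong xs (λ a → ℚ.*-identityˡ (f (g a))))

-- Two vectors are equal iff every linear functional agrees on them; unlike the coefficients,
-- functionals compose well with `lin` and `⊗`.
infix 4 _≋_
record _≋_ (x y : FS A) : Set where
  field eval : ∀ f → linℚ f x ≡ linℚ f y
open _≋_ public

≋-setoid : Set → Setoid _ _
≋-setoid A = record
  { Carrier = FS A
  ; _≈_ = _≋_
  ; isEquivalence = record
    { refl  = λ where .eval f → refl
    ; sym   = λ e → λ where .eval f → sym (e .eval f)
    ; trans = λ e e′ → λ where .eval f → trans (e .eval f) (e′ .eval f)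
    }
  }

module ≋ {A : Set} = Setoid (≋-setoid A)
module ≋-Reasoning {A : Set} = SetoidReasoning (≋-setoid A)

lin-congʳ : ∀ (g : A → FS B) {x y} → x ≋ y → lin g x ≋ lin g y
lin-congʳ g {x} {y} e .eval f = trans (linℚ-lin f g x) (trans (e .eval _) (sym (linℚ-lin f g y)))

lin-congˡ : ∀ {g h : A → FS B} x → (∀ a → g a ≋ h a) → lin g x ≋ lin h x
lin-congˡ {g = g} {h} x e .eval f = trans (linℚ-lin f g x)
  (trans (linℚ-cong x (λ a → e a .eval f)) (sym (linℚ-lin f h x)))

lin-lin : ∀ (g : B → FS C) (h : A → FS B) x → lin g (lin h x) ≋ lin (λ a → lin g (h a)) x
lin-lin g h x .eval f = let open ≡-Reasoning in begin
  linℚ f (lin g (lin h x))                        ≡⟨ linℚ-lin f g (lin h x) ⟩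
  linℚ (λ b → linℚ f (g b)) (lin h x)             ≡⟨ linℚ-lin _ h x ⟩
  linℚ (λ a → linℚ (λ b → linℚ f (g b)) (h a)) x  ≡⟨ linℚ-cong x (λ a → linℚ-lin f g (h a)) ⟨
  linℚ (λ a → linℚ f (lin g (h a))) x             ≡⟨ linℚ-lin f (λ a → lin g (h a)) x ⟨
  linℚ f (lin (λ a → lin g (h a)) x)              ∎

lin-bas : ∀ (g : A → FS B) a → lin g (bas a) ≋ g a
lin-bas g a .eval f = trans (linℚ-lin f g (bas a)) (linℚ-bas (λ b → linℚ f (g b)) a)

lin-id : ∀ (x : FS A) → lin bas x ≋ x
lin-id x .eval f = trans (linℚ-lin f bas x) (linℚ-cong x (linℚ-bas f))

lin-⊗ : ∀ {A′ B′ : Set} (g : A → FS A′) (h : B → FS B′) x y →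
  lin (λ p → g (proj₁ p) ⊗ h (proj₂ p)) (x ⊗ y) ≋ lin g x ⊗ lin h y
lin-⊗ g h x y .eval f = let open ≡-Reasoning in begin
  linℚ f (lin (λ p → g (proj₁ p) ⊗ h (proj₂ p)) (x ⊗ y))
    ≡⟨ trans (linℚ-lin f _ (x ⊗ y)) (linℚ-⊗ _ x y) ⟩
  linℚ (λ a → linℚ (λ b → linℚ f (g a ⊗ h b)) y) x
    ≡⟨ linℚ-cong x (λ a → linℚ-cong y (λ b → linℚ-⊗ f (g a) (h b))) ⟩
  linℚ (λ a → linℚ (λ b → linℚ (λ a′ → linℚ (λ b′ → f (a′ , b′)) (h b)) (g a)) y) x
    -- The sum over `y` has to move inside the sum over `g a`, next to `h`, before it can be
    -- absorbed into `lin h y`.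
    ≡⟨ linℚ-cong x (λ a → linℚ-swap (λ b a′ → linℚ (λ b′ → f (a′ , b′)) (h b)) y (g a)) ⟩
  linℚ (λ a → linℚ (λ a′ → linℚ (λ b → linℚ (λ b′ → f (a′ , b′)) (h b)) y) (g a)) x
    ≡⟨ linℚ-cong x (λ a → linℚ-cong (g a) (λ a′ → linℚ-lin _ h y)) ⟨
  linℚ (λ a → linℚ (λ a′ → linℚ (λ b′ → f (a′ , b′)) (lin h y)) (g a)) x
    ≡⟨ linℚ-lin _ g x ⟨
  linℚ (λ a′ → linℚ (λ b′ → f (a′ , b′)) (lin h y)) (lin g x)
    ≡⟨ linℚ-⊗ f (lin g x) (lin h y) ⟨
  linℚ f (lin g x ⊗ lin h y) ∎

⊗-cong : ∀ {x x′ : FS A} {y y′ : FS B} → x ≋ x′ → y ≋ y′ → x ⊗ y ≋ x′ ⊗ y′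
⊗-cong {x = x} {x′} {y} {y′} e e′ .eval f = let open ≡-Reasoning in begin
  linℚ f (x ⊗ y)                              ≡⟨ linℚ-⊗ f x y ⟩
  linℚ (λ a → linℚ (λ b → f (a , b)) y) x     ≡⟨ linℚ-cong x (λ a → e′ .eval _) ⟩
  linℚ (λ a → linℚ (λ b → f (a , b)) y′) x    ≡⟨ e .eval _ ⟩
  linℚ (λ a → linℚ (λ b → f (a , b)) y′) x′   ≡⟨ linℚ-⊗ f x′ y′ ⟨
  linℚ f (x′ ⊗ y′)                            ∎

bas-⊗ : ∀ (a : A) (b : B) → bas a ⊗ bas b ≋ bas (a , b)
bas-⊗ a b .eval f = trans (linℚ-⊗ f (bas a) (bas b))
  (trans (linℚ-bas (λ c → linℚ (λ d → f (c , d)) (bas b)) a)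
         (trans (linℚ-bas (λ d → f (a , d)) b) (sym (linℚ-bas f (a , b)))))

∑Fin : (N : ℕ) → (Fin N → ℚ) → ℚ
∑Fin zero    f = 0ℚ
∑Fin (suc N) f = f Fin.zero ℚ.+ ∑Fin N (f ∘ Fin.suc)

linℚ-sumV : ∀ (f : A → ℚ) N (xs : Fin N → FS A) → linℚ f (sumV N xs) ≡ ∑Fin N (λ i → linℚ f (xs i))
linℚ-sumV f zero    xs = refl
linℚ-sumV f (suc N) xs = trans (linℚ-++ f (xs Fin.zero) _)
  (cong (linℚ f (xs Fin.zero) ℚ.+_) (linℚ-sumV f N (xs ∘ Fin.suc)))

∑Fin-cong : ∀ N {f g : Fin N → ℚ} → (∀ i → f i ≡ g i) → ∑Fin N f ≡ ∑Fin N g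
∑Fin-cong zero    e = refl
∑Fin-cong (suc N) e = cong₂ ℚ._+_ (e Fin.zero) (∑Fin-cong N (e ∘ Fin.suc))

∑Fin-zero : ∀ N {f : Fin N → ℚ} → (∀ i → f i ≡ 0ℚ) → ∑Fin N f ≡ 0ℚ
∑Fin-zero zero    e = refl
∑Fin-zero (suc N) e = cong₂ ℚ._+_ (e Fin.zero) (∑Fin-zero N (e ∘ Fin.suc))

∑Fin-single : ∀ {N} (k : Fin N) (f : Fin N → ℚ) → (∀ i → i ≢ k → f i ≡ 0ℚ) → ∑Fin N f ≡ f k
∑Fin-single {suc N} Fin.zero f z =
  trans (cong (f Fin.zero ℚ.+_) (∑Fin-zero N (λ i → z (Fin.suc i) (λ ())))) (ℚ.+-identityʳ _)
∑Fin-single {suc N} (Fin.suc k) f z =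
  trans (cong₂ ℚ._+_ (z Fin.zero (λ ())) (∑Fin-single k (f ∘ Fin.suc) (λ i ne → z (Fin.suc i) (λ { refl → ne refl }))))
        (ℚ.+-identityˡ _)

∑Fin-linℚ : ∀ N (h : Fin N → A → ℚ) x → ∑Fin N (λ i → linℚ (h i) x) ≡ linℚ (λ a → ∑Fin N (λ i → h i a)) x
∑Fin-linℚ zero    h x = sym (linℚ-zero x)
∑Fin-linℚ (suc N) h x = trans (cong (linℚ (h Fin.zero) x ℚ.+_) (∑Fin-linℚ N (h ∘ Fin.suc) x)) (add x)
  where
  open ℚ-Solver
  f g : _ → ℚ
  f = h Fin.zero
  g a = ∑Fin N (λ i → h (Fin.suc i) a)
  add : ∀ x → linℚ f x ℚ.+ linℚ g x ≡ linℚ (λ a → f a ℚ.+ g a) x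
  add [] = refl
  add ((q , a) ∷ x) = trans
    (solve 5 (λ q s t u v → (q :* s :+ t) :+ (q :* u :+ v) := q :* (s :+ u) :+ (t :+ v)) refl
      q (f a) (linℚ f x) (g a) (linℚ g x))
    (cong (q ℚ.* (f a ℚ.+ g a) ℚ.+_) (add x))

-- Coefficients versus linear functionals

module _ (_≟_ : DecidableEquality A) where

  abstract
    -- The functional dual to the basis vector `a`. It is opaque, so that case distinctions on `_≟_`
    -- leave it intact; `δ-≡` and `δ-≢` are its interface.
    δ : A → A → ℚ
    δ a b = ⟦ does (b ≟ a) ⟧

    δ-≡ : ∀ a → δ a a ≡ 1ℚ
    δ-≡ a = cong ⟦_⟧ (dec-true (a ≟ a) refl)

    δ-≢ : ∀ {a b} → b ≢ a → δ a b ≡ 0ℚ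
    δ-≢ {a} {b} ne = cong ⟦_⟧ (dec-false (b ≟ a) ne)

  coeff-linℚ : ∀ x a → coeff _≟_ x a ≡ linℚ (δ a) x
  coeff-linℚ [] a = refl
  coeff-linℚ ((q , b) ∷ x) a with b ≟ a
  ... | yes refl = cong₂ ℚ._+_ (sym (trans (cong (q ℚ.*_) (δ-≡ a)) (ℚ.*-identityʳ q))) (coeff-linℚ x a)
  ... | no ne    = trans (coeff-linℚ x a) (sym (trans
    (cong (ℚ._+ linℚ (δ a) x) (trans (cong (q ℚ.*_) (δ-≢ ne)) (ℚ.*-zeroʳ q))) (ℚ.+-identityˡ _)))

  ≋⇒Eqv : ∀ {x y} → x ≋ y → Eqv _≟_ x y
  ≋⇒Eqv {x} {y} e a = trans (coeff-linℚ x a) (trans (e .eval (δ a)) (sym (coeff-linℚ y a)))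

  -- By induction on the entries: `(q , b)` contributes through the single index `a ≡ b` of `s`.
  -- Elements of `s` outside `x` have coefficient 0, so `s` may be larger than the support.
  linℚ-coeff : ∀ (f : A → ℚ) {s} x → Unique s → (∀ {a} → a ∈ map proj₂ x → a ∈ s) →
    linℚ f x ≡ ∑ s (λ a → coeff _≟_ x a ℚ.* f a)
  linℚ-coeff f {s} [] u i = sym (∑-zero s (λ {a} _ → ℚ.*-zeroˡ (f a)))
  linℚ-coeff f {s} ((q , b) ∷ x) u i = let open ≡-Reasoning in begin
    q ℚ.* f b ℚ.+ linℚ f x
      ≡⟨ cong₂ ℚ._+_ (sym (trans (∑-single (λ a → (q ℚ.* δ a b) ℚ.* f a) u (i (here refl)) (λ {a} _ a≢b → off a≢b)) on))
                     (linℚ-coeff f x u (i ∘ there)) ⟩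
    ∑ s (λ a → (q ℚ.* δ a b) ℚ.* f a) ℚ.+ ∑ s (λ a → coeff _≟_ x a ℚ.* f a)
      ≡⟨ ∑-+ s _ _ ⟨
    ∑ s (λ a → (q ℚ.* δ a b) ℚ.* f a ℚ.+ coeff _≟_ x a ℚ.* f a)
      ≡⟨ ∑-cong s (λ a → trans (sym (ℚ.*-distribʳ-+ (f a) (q ℚ.* δ a b) (coeff _≟_ x a)))
           (cong (ℚ._* f a) (trans (cong (q ℚ.* δ a b ℚ.+_) (coeff-linℚ x a)) (sym (coeff-linℚ ((q , b) ∷ x) a))))) ⟩
    ∑ s (λ a → coeff _≟_ ((q , b) ∷ x) a ℚ.* f a) ∎
    where
    on : (q ℚ.* δ b b) ℚ.* f b ≡ q ℚ.* f b
    on = cong (ℚ._* f b) (trans (cong (q ℚ.*_) (δ-≡ b)) (ℚ.*-identityʳ q))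
    off : ∀ {a} → a ≢ b → (q ℚ.* δ a b) ℚ.* f a ≡ 0ℚ
    off {a} ne = trans (cong (ℚ._* f a) (trans (cong (q ℚ.*_) (δ-≢ (ne ∘ sym))) (ℚ.*-zeroʳ q)))
                       (ℚ.*-zeroˡ (f a))

  Eqv⇒≋ : ∀ x y → Eqv _≟_ x y → x ≋ y
  Eqv⇒≋ x y e .eval f = let open ≡-Reasoning in begin
    linℚ f x                              ≡⟨ linℚ-coeff f x s! (s⊇ ∘ ∈-++⁺ˡ) ⟩
    ∑ s (λ a → coeff _≟_ x a ℚ.* f a)     ≡⟨ ∑-cong s (λ a → cong (ℚ._* f a) (e a)) ⟩
    ∑ s (λ a → coeff _≟_ y a ℚ.* f a)     ≡⟨ linℚ-coeff f y s! (s⊇ ∘ ∈-++⁺ʳ (map proj₂ x)) ⟨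
    linℚ f y                              ∎
    where
    -- One duplicate-free support for both vectors makes the two functionals the same sum, up to
    -- coefficients that agree by hypothesis.
    s : List A
    s = deduplicate _≟_ (map proj₂ x ++ map proj₂ y)
    s! : Unique s
    s! = deduplicate-! _≟_ (map proj₂ x ++ map proj₂ y)
    s⊇ : ∀ {a} → a ∈ map proj₂ x ++ map proj₂ y → a ∈ s
    s⊇ = ∈-deduplicate⁺ _≟_

-- Words of permutations

++-cancel : ∀ {x x′ y y′ : List A} → length x ≡ length x′ → x ++ y ≡ x′ ++ y′ → x ≡ x′ × y ≡ y′
++-cancel {x = []}    {[]}     e eq = refl , eq
++-cancel {x = a ∷ x} {b ∷ x′} e eq
  with eq₁ , eq₂ ← List.∷-injective eq
  with eq₃ , eq₄ ← ++-cancel {x = x} {x′} (ℕ.suc-injective e) eq₂ = cong₂ _∷_ eq₁ eq₃ , eq₄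

Unique-resp-↭ : ∀ {xs ys : List A} → xs ↭ ys → Unique xs → Unique ys
Unique-resp-↭ {A} p = ↭ₛ.Unique-resp-↭ (setoid A) (↭⇒↭ₛ p)

-- Pigeonhole: removing the head of `xs` from `ys` keeps the inclusion and the bound on lengths.
-- Used with `range1 n` as `xs` it says that a word hitting all values is a permutation, and with
-- the word as `xs` that an injective word with bounded letters is one.
Unique-⊆-↭ : ∀ {xs ys : List A} → Unique xs → (∀ {a} → a ∈ xs → a ∈ ys) → length ys ≤ length xs → ys ↭ xs
Unique-⊆-↭ {xs = []}     {[]} u s l = ↭-refl
Unique-⊆-↭ {xs = x ∷ xs} {ys} (px ∷ u) s l with as , bs , refl ← ∈-∃++ (s (here refl)) =
  ↭-trans (shift x as bs) (prep x (Unique-⊆-↭ u sub len))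
  where
  sub : ∀ {a} → a ∈ xs → a ∈ as ++ bs
  sub a∈ with ∈-resp-↭ (shift x as bs) (s (there a∈))
  ... | here refl = contradiction refl (All.lookup px a∈)
  ... | there q   = q
  len : length (as ++ bs) ≤ length xs
  len = ℕ.≤-pred (subst (_≤ suc (length xs)) (↭-length (shift x as bs)) l)

range1≡ : ∀ n → range1 n ≡ applyUpTo suc n
range1≡ n = List.map-upTo suc n

length-range1 : ∀ n → length (range1 n) ≡ n
length-range1 n = trans (cong length (range1≡ n)) (List.length-applyUpTo suc n)

range1-! : ∀ n → Unique (range1 n)
range1-! n = Unique.map⁺ ℕ.suc-injective (Unique.upTo⁺ n)

∈-range1⁺ : ∀ {i n} → 1 ≤ i → i ≤ n → i ∈ range1 n
∈-range1⁺ {suc i} _ i≤n = ∈-map⁺ suc (∈-upTo⁺ i≤n)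

∈-range1⁻ : ∀ {i n} → i ∈ range1 n → 1 ≤ i × i ≤ n
∈-range1⁻ i∈ with _ , j∈ , refl ← ∈-map⁻ suc i∈ = s≤s z≤n , ∈-upTo⁻ j∈

IsPermWord : List ℕ → Set
IsPermWord w = w ↭ range1 (length w)

isPermWord : ∀ {w} → Unique w → (∀ {a} → a ∈ w → 1 ≤ a × a ≤ length w) → IsPermWord w
isPermWord {w} u b = ↭-sym (Unique-⊆-↭ u (λ a∈ → ∈-range1⁺ (proj₁ (b a∈)) (proj₂ (b a∈)))
                                         (ℕ.≤-reflexive (length-range1 (length w))))

IsPermWord⇒Unique : ∀ {w} → IsPermWord w → Unique w
IsPermWord⇒Unique p = Unique-resp-↭ (↭-sym p) (range1-! _)

T⇒IsPermWord : ∀ {w} → T (isPermᵇ w) → IsPermWord w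
T⇒IsPermWord {w} t = Unique-⊆-↭ (range1-! (length w)) contains (ℕ.≤-reflexive (sym (length-range1 (length w))))
  where
  contains : ∀ {i} → i ∈ range1 (length w) → i ∈ w
  contains i∈ = Any.map (λ {x} e → sym (ℕ.≡ᵇ⇒≡ x _ e)) (Any.any⁻ _ w (All.lookup (All.all⁺ _ _ t) i∈))

IsPermWord⇒T : ∀ {w} → IsPermWord w → T (isPermᵇ w)
IsPermWord⇒T {w} p = All.all⁻ _ (All.tabulate λ {i} i∈ →
  Any.any⁺ _ (Any.map (λ { refl → ℕ.≡⇒≡ᵇ i i refl }) (∈-resp-↭ (↭-sym p) i∈)))

word-↭ : ∀ u → IsPermWord (word u)
word-↭ (perm w p) = T⇒IsPermWord (recompute (T? (isPermᵇ w)) p)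

word-! : ∀ u → Unique (word u)
word-! u = IsPermWord⇒Unique (word-↭ u)

word-bounds : ∀ u {a} → a ∈ word u → 1 ≤ a × a ≤ size u
word-bounds u a∈ = ∈-range1⁻ (∈-resp-↭ (word-↭ u) a∈)

word-injective : ∀ {u v} → word u ≡ word v → u ≡ v
word-injective {perm w p} {perm .w q} refl = refl

size-0 : ∀ u → size u ≡ 0 → u ≡ perm [] _
size-0 (perm [] _) _ = refl

mkPerm?-just : ∀ w {u} → mkPerm? w ≡ just u → word u ≡ w
mkPerm?-just w e with T? (isPermᵇ w)
mkPerm?-just w refl | yes p = refl

mkPerm?-perm : ∀ {w} (p : IsPermWord w) → mkPerm? w ≡ just (perm w (IsPermWord⇒T p))
mkPerm?-perm {w} p with T? (isPermᵇ w)
... | yes _ = refl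
... | no ¬t = contradiction (IsPermWord⇒T p) ¬t

word-toPerm : ∀ {w} → IsPermWord w → word (toPerm w) ≡ w
word-toPerm {w} p rewrite mkPerm?-perm p = refl

-- Serves twice: `suc (cnt a w)` is the letter replacing `a` in `stW w`, and `cnt x xs` is the
-- contribution of `x` to `invW (x ∷ xs)`.
cnt : ℕ → List ℕ → ℕ
cnt a w = length (filter (λ b → b <? a) w)

cnt-< : ∀ {a x w} → x < a → cnt a (x ∷ w) ≡ suc (cnt a w)
cnt-< {a} x<a = cong length (List.filter-accept (_<? a) x<a)

cnt-≮ : ∀ {a x w} → ¬ x < a → cnt a (x ∷ w) ≡ cnt a w
cnt-≮ {a} x≮a = cong length (List.filter-reject (_<? a) x≮a)

cnt-mono-≤ : ∀ {a b} w → a ≤ b → cnt a w ≤ cnt b w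
cnt-mono-≤ [] a≤b = z≤n
cnt-mono-≤ {a} {b} (x ∷ w) a≤b with x <? a | x <? b
... | yes p | yes q rewrite cnt-< {w = w} p | cnt-< {w = w} q = s≤s (cnt-mono-≤ w a≤b)
... | yes p | no ¬q = contradiction (ℕ.<-≤-trans p a≤b) ¬q
... | no ¬p | yes q rewrite cnt-≮ {w = w} ¬p | cnt-< {w = w} q = ℕ.m≤n⇒m≤1+n (cnt-mono-≤ w a≤b)
... | no ¬p | no ¬q rewrite cnt-≮ {w = w} ¬p | cnt-≮ {w = w} ¬q = cnt-mono-≤ w a≤b

cnt-mono-< : ∀ {a b w} → a ∈ w → a < b → cnt a w < cnt b w
cnt-mono-< {a} {b} {x ∷ w} (here refl) a<b
  rewrite cnt-≮ {w = w} (ℕ.<-irrefl {x} refl) | cnt-< {w = w} a<b = s≤s (cnt-mono-≤ w (ℕ.<⇒≤ a<b))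
cnt-mono-< {a} {b} {x ∷ w} (there a∈) a<b with x <? a | x <? b
... | yes p | yes q rewrite cnt-< {w = w} p | cnt-< {w = w} q = s≤s (cnt-mono-< a∈ a<b)
... | yes p | no ¬q = contradiction (ℕ.<-trans p a<b) ¬q
... | no ¬p | yes q rewrite cnt-≮ {w = w} ¬p | cnt-< {w = w} q = ℕ.m≤n⇒m≤1+n (cnt-mono-< a∈ a<b)
... | no ¬p | no ¬q rewrite cnt-≮ {w = w} ¬p | cnt-≮ {w = w} ¬q = cnt-mono-< a∈ a<b

cnt<length : ∀ {a w} → a ∈ w → cnt a w < length w
cnt<length {a} {x ∷ w} (here refl) rewrite cnt-≮ {w = w} (ℕ.<-irrefl {x} refl) = s≤s (List.length-filter (_<? a) w)
cnt<length {a} {x ∷ w} (there a∈) with x <? a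
... | yes p rewrite cnt-< {w = w} p  = s≤s (cnt<length a∈)
... | no ¬p rewrite cnt-≮ {w = w} ¬p = ℕ.m≤n⇒m≤1+n (cnt<length a∈)

cnt-applyUpTo : ∀ {a} (f : ℕ → ℕ) n k → (∀ i → i < k → f i < a) → (∀ i → k ≤ i → ¬ f i < a) → k ≤ n →
  cnt a (applyUpTo f n) ≡ k
cnt-applyUpTo f zero    zero    _ _ _ = refl
cnt-applyUpTo {a} f (suc n) zero l g _ rewrite cnt-≮ {w = applyUpTo (f ∘ suc) n} (g 0 z≤n) =
  cnt-applyUpTo (f ∘ suc) n zero (λ _ ()) (λ i _ → g (suc i) z≤n) z≤n
cnt-applyUpTo {a} f (suc n) (suc k) l g (s≤s k≤n) rewrite cnt-< {w = applyUpTo (f ∘ suc) n} (l 0 (s≤s z≤n)) =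
  cong suc (cnt-applyUpTo (f ∘ suc) n k (λ i i<k → l (suc i) (s≤s i<k)) (λ i k≤i → g (suc i) (s≤s k≤i)) k≤n)

-- Exactly the letters 1, ..., k of a permutation word lie below k + 1, so every letter exceeds its
-- rank by one.
stW-id : ∀ {w} → IsPermWord w → stW w ≡ w
stW-id {w} p = List.map-id-local (All.tabulate rank)
  where
  rank : ∀ {a} → a ∈ w → suc (cnt a w) ≡ a
  rank {zero}  a∈ with () ← proj₁ (∈-range1⁻ (∈-resp-↭ p a∈))
  rank {suc k} a∈ = cong suc (trans (↭-length (filter-↭ (_<? suc k) p)) (trans (cong (cnt (suc k)) (range1≡ (length w)))
    (cnt-applyUpTo suc (length w) k (λ i → s≤s) (λ { i k≤i (s≤s i<k) → ℕ.<-irrefl refl (ℕ.<-≤-trans i<k k≤i) })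
      (ℕ.<⇒≤ (proj₂ (∈-range1⁻ (∈-resp-↭ p a∈)))))))

length-stW : ∀ w → length (stW w) ≡ length w
length-stW w = List.length-map _ w

map-! : ∀ {f : A → B} {xs} → (∀ {x y} → x ∈ xs → y ∈ xs → f x ≡ f y → x ≡ y) → Unique xs → Unique (map f xs)
map-! inj [] = []
map-! {f = f} {x ∷ xs} inj (px ∷ u) =
  All.map⁺ (All.tabulate (λ {y} y∈ e → All.lookup px y∈ (inj (here refl) (there y∈) e))) ∷
  map-! (λ x∈ y∈ → inj (there x∈) (there y∈)) u

-- Ranks increase strictly along the letters of `w`, which gives injectivity; no letter counts
-- itself, which gives the upper bound.
stW-perm : ∀ {w} → Unique w → IsPermWord (stW w)
stW-perm {w} u = isPermWord (map-! inj u) bounds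
  where
  inj : ∀ {x y} → x ∈ w → y ∈ w → suc (cnt x w) ≡ suc (cnt y w) → x ≡ y
  inj {x} {y} x∈ y∈ e with ℕ.<-cmp x y
  ... | tri< x<y _ _ = contradiction (ℕ.suc-injective e) (ℕ.<⇒≢ (cnt-mono-< x∈ x<y))
  ... | tri≈ _ x≡y _ = x≡y
  ... | tri> _ _ y<x = contradiction (sym (ℕ.suc-injective e)) (ℕ.<⇒≢ (cnt-mono-< y∈ y<x))
  bounds : ∀ {a} → a ∈ stW w → 1 ≤ a × a ≤ length (stW w)
  bounds a∈ with b , b∈ , refl ← ∈-map⁻ _ a∈ rewrite length-stW w = s≤s z≤n , cnt<length b∈

-- Uniqueness is what keeps `toPerm` away from its default: a repeated letter would have a repeated
-- rank, and `st w` would be the empty permutation.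
st-word : ∀ {w} → Unique w → word (st w) ≡ stW w
st-word u = word-toPerm (stW-perm u)

st-size : ∀ {w} → Unique w → size (st w) ≡ length w
st-size {w} u = trans (cong length (st-word u)) (length-stW w)

-- The shifted concatenation and its monoid laws

infixr 5 _⊹_
_⊹_ : Perm → Perm → Perm
u ⊹ v = perm (map (size v +_) (word u) ++ word v) (IsPermWord⇒T (isPermWord unique bounds))
  where
  len : length (map (size v +_) (word u) ++ word v) ≡ size u + size v
  len = trans (List.length-++ (map (size v +_) (word u))) (cong (_+ size v) (List.length-map _ (word u)))
  unique : Unique (map (size v +_) (word u) ++ word v)
  unique = Unique.++⁺ (Unique.map⁺ (ℕ.+-cancelˡ-≡ (size v) _ _) (word-! u)) (word-! v) disjoint
    where
    disjoint : Disjoint (map (size v +_) (word u)) (word v)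
    disjoint (a∈ , a∈v) with b , b∈ , refl ← ∈-map⁻ _ a∈ =
      -- A shifted letter is `size v + b` with `b` at least 1, hence above every letter of `v`; `b`
      -- is rewritten as a successor to display this.
      ℕ.m+1+n≰m (size v) {ℕ.pred b} (subst (λ t → size v + t ≤ size v)
        (sym (ℕ.suc-pred b {{ℕ.>-nonZero (proj₁ (word-bounds u b∈))}})) (proj₂ (word-bounds v a∈v)))
  bounds : ∀ {a} → a ∈ map (size v +_) (word u) ++ word v → 1 ≤ a × a ≤ length (map (size v +_) (word u) ++ word v)
  bounds a∈ rewrite len with ∈-++⁻ (map (size v +_) (word u)) a∈
  ... | inj₂ a∈v = proj₁ (word-bounds v a∈v) , ℕ.≤-trans (proj₂ (word-bounds v a∈v)) (ℕ.m≤n+m _ (size u))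
  ... | inj₁ a∈u with b , b∈ , refl ← ∈-map⁻ _ a∈u =
    ℕ.≤-trans (proj₁ (word-bounds u b∈)) (ℕ.m≤n+m b (size v)) ,
    subst (size v + b ≤_) (ℕ.+-comm (size v) (size u)) (ℕ.+-monoʳ-≤ (size v) (proj₂ (word-bounds u b∈)))

size-⊹ : ∀ u v → size (u ⊹ v) ≡ size u + size v
size-⊹ u v = trans (List.length-++ (map (size v +_) (word u))) (cong (_+ size v) (List.length-map _ (word u)))

⊹-assoc : ∀ u v w → (u ⊹ v) ⊹ w ≡ u ⊹ (v ⊹ w)
⊹-assoc u v w = word-injective (begin
  map (size w +_) (map (size v +_) (word u) ++ word v) ++ word w
    ≡⟨ cong (_++ word w) (List.map-++ _ (map (size v +_) (word u)) (word v)) ⟩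
  (map (size w +_) (map (size v +_) (word u)) ++ map (size w +_) (word v)) ++ word w
    ≡⟨ List.++-assoc (map (size w +_) (map (size v +_) (word u))) _ _ ⟩
  map (size w +_) (map (size v +_) (word u)) ++ map (size w +_) (word v) ++ word w
    ≡⟨ cong (_++ _) (trans (sym (List.map-∘ (word u))) (List.map-cong shift-shift (word u))) ⟩
  map (size (v ⊹ w) +_) (word u) ++ map (size w +_) (word v) ++ word w ∎)
  where
  open ≡-Reasoning
  shift-shift : ∀ a → size w + (size v + a) ≡ size (v ⊹ w) + a
  shift-shift a = trans (sym (ℕ.+-assoc (size w) (size v) a))
    (cong (_+ a) (trans (ℕ.+-comm (size w) (size v)) (sym (size-⊹ v w))))

⊹-identityʳ : ∀ u → u ⊹ perm [] _ ≡ u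
⊹-identityʳ u = word-injective (trans (List.++-identityʳ _) (List.map-id (word u)))

-- The enumeration of all permutations is complete and free of repetitions

∈-insertAll : ∀ {x : ℕ} as {bs} → as ++ x ∷ bs ∈ insertAll x (as ++ bs)
∈-insertAll [] {[]}     = here refl
∈-insertAll [] {b ∷ bs} = here refl
∈-insertAll (a ∷ as)    = there (∈-map⁺ (a ∷_) (∈-insertAll as))

insertAll-↭ : ∀ {x v} ys → v ∈ insertAll x ys → v ↭ x ∷ ys
insertAll-↭ []       (here refl) = ↭-refl
insertAll-↭ (y ∷ ys) (here refl) = ↭-refl
insertAll-↭ {x} (y ∷ ys) (there v∈) with v′ , v′∈ , refl ← ∈-map⁻ (y ∷_) v∈ =
  ↭-trans (prep y (insertAll-↭ ys v′∈)) (swap y x ↭-refl)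

insertAll-! : ∀ {x} ys → x ∉ ys → Unique (insertAll x ys)
insertAll-! []       x∉ = [] ∷ []
insertAll-! {x} (y ∷ ys) x∉ =
  All.tabulate (λ v∈ e → x∉ (here (distinct v∈ e))) ∷ Unique.map⁺ List.∷-injectiveʳ (insertAll-! ys (x∉ ∘ there))
  where
  distinct : ∀ {v} → v ∈ map (y ∷_) (insertAll x ys) → x ∷ y ∷ ys ≡ v → x ≡ y
  distinct v∈ e with _ , _ , refl ← ∈-map⁻ (y ∷_) v∈ = List.∷-injectiveˡ e

-- Deletion is a left inverse of insertion, so insertions of a new letter into distinct words never
-- coincide. This is the reason why `permWords` has no repetitions.
insertAll-delete : ∀ {x v} ys → x ∉ ys → v ∈ insertAll x ys → filter (λ z → ¬? (z ℕ.≟ x)) v ≡ ys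
insertAll-delete {x} ys x∉ v∈ = go ys x∉ v∈
  where
  del : List ℕ → List ℕ
  del = filter (λ z → ¬? (z ℕ.≟ x))
  keep : ∀ ys → x ∉ ys → del ys ≡ ys
  keep ys x∉ = List.filter-all (λ z → ¬? (z ℕ.≟ x)) (All.tabulate (λ z∈ e → x∉ (subst (_∈ ys) e z∈)))
  skip : ∀ ys → x ∉ ys → del (x ∷ ys) ≡ ys
  skip ys x∉ = trans (List.filter-reject (λ z → ¬? (z ℕ.≟ x)) (λ ne → ne refl)) (keep ys x∉)
  go : ∀ {v} ys → x ∉ ys → v ∈ insertAll x ys → del v ≡ ys
  go []       x∉ (here refl) = skip [] x∉
  go (y ∷ ys) x∉ (here refl) = skip (y ∷ ys) x∉
  go (y ∷ ys) x∉ (there v∈) with v′ , v′∈ , refl ← ∈-map⁻ (y ∷_) v∈ =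
    trans (List.filter-accept (λ z → ¬? (z ℕ.≟ x)) (λ { refl → x∉ (here refl) }))
          (cong (y ∷_) (go ys (x∉ ∘ there) v′∈))

range1-∷ʳ : ∀ n → range1 n ++ suc n ∷ [] ≡ range1 (suc n)
range1-∷ʳ n = trans (sym (List.map-++ suc (upTo n) (n ∷ []))) (cong (map suc) (List.upTo-∷ʳ n))

range1-suc-↭ : ∀ n → range1 (suc n) ↭ suc n ∷ range1 n
range1-suc-↭ n = ↭-trans (↭-reflexive (sym (range1-∷ʳ n)))
  (↭-trans (shift (suc n) (range1 n) []) (↭-reflexive (cong (suc n ∷_) (List.++-identityʳ (range1 n)))))

-- The largest letter occurs somewhere; removing it leaves an arrangement of the smaller ones, into
-- which `insertAll` puts it back.
∈-permWords⁺ : ∀ n {w} → w ↭ range1 n → w ∈ permWords n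
∈-permWords⁺ zero {[]} p = here refl
∈-permWords⁺ zero {x ∷ w} p with () ← ↭-length p
∈-permWords⁺ (suc n) {w} p
  with as , bs , refl ← ∈-∃++ (∈-resp-↭ (↭-sym (↭-trans p (range1-suc-↭ n))) (here refl)) =
  ∈-concatMap⁺ (insertAll (suc n)) (Any.map (λ { refl → ∈-insertAll as }) (∈-permWords⁺ n
    (drop-mid as [] (↭-trans p (range1-suc-↭ n)))))

∈-permWords⁻ : ∀ n {w} → w ∈ permWords n → w ↭ range1 n
∈-permWords⁻ zero (here refl) = ↭-refl
∈-permWords⁻ (suc n) w∈
  with w′ , w∈′ , w′∈ ← find (∈-concatMap⁻ (insertAll (suc n)) w∈) =
  ↭-trans (insertAll-↭ w′ w′∈) (↭-trans (prep (suc n) (∈-permWords⁻ n w∈′)) (↭-sym (range1-suc-↭ n)))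

suc∉permWords : ∀ {n w} → w ∈ permWords n → suc n ∉ w
suc∉permWords {n} w∈ n∈ = ℕ.1+n≰n (proj₂ (∈-range1⁻ (∈-resp-↭ (∈-permWords⁻ n w∈) n∈)))

permWords-! : ∀ n → Unique (permWords n)
permWords-! zero = [] ∷ []
permWords-! (suc n) = Unique.concat⁺
  (All.map⁺ (All.tabulate (λ {w} w∈ → insertAll-! w (suc∉permWords w∈))))
  (AllPairs.map⁺ (disjoint (permWords n) id (permWords-! n)))
  where
  disjoint : ∀ ws → (∀ {w} → w ∈ ws → w ∈ permWords n) → Unique ws →
    AllPairs (λ w w′ → Disjoint (insertAll (suc n) w) (insertAll (suc n) w′)) ws
  disjoint [] s [] = []
  disjoint (w ∷ ws) s (pw ∷ u) = All.tabulate (λ {w′} w′∈ (v∈ , v∈′) → All.lookup pw w′∈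
      (trans (sym (insertAll-delete w (suc∉permWords (s (here refl))) v∈))
             (insertAll-delete w′ (suc∉permWords (s (there w′∈))) v∈′)))
    ∷ disjoint ws (s ∘ there) u

∈-mapMaybe-mkPerm? : ∀ ws {u} → u ∈ mapMaybe mkPerm? ws → word u ∈ ws
∈-mapMaybe-mkPerm? (w ∷ ws) u∈ with mkPerm? w in eq
∈-mapMaybe-mkPerm? (w ∷ ws) u∈           | nothing = there (∈-mapMaybe-mkPerm? ws u∈)
∈-mapMaybe-mkPerm? (w ∷ ws) (here refl)  | just u  = here (mkPerm?-just w eq)
∈-mapMaybe-mkPerm? (w ∷ ws) (there u∈)   | just _  = there (∈-mapMaybe-mkPerm? ws u∈)

mapMaybe-mkPerm?-! : ∀ {ws} → Unique ws → Unique (mapMaybe mkPerm? ws)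
mapMaybe-mkPerm?-! [] = []
mapMaybe-mkPerm?-! {w ∷ ws} (pw ∷ u) with mkPerm? w in eq
... | nothing = mapMaybe-mkPerm?-! u
... | just v  = All.tabulate (λ {v′} v′∈ e → All.lookup pw (∈-mapMaybe-mkPerm? ws v′∈)
                  (trans (sym (mkPerm?-just w eq)) (cong word e))) ∷ mapMaybe-mkPerm?-! u

∈-mapMaybe-mkPerm?⁺ : ∀ ws u → word u ∈ ws → u ∈ mapMaybe mkPerm? ws
∈-mapMaybe-mkPerm?⁺ (w ∷ ws) u (here refl) rewrite mkPerm?-perm (word-↭ u) = here refl
∈-mapMaybe-mkPerm?⁺ (w ∷ ws) u (there u∈) with mkPerm? w
... | nothing = ∈-mapMaybe-mkPerm?⁺ ws u u∈
... | just _  = there (∈-mapMaybe-mkPerm?⁺ ws u u∈)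

allPerms-! : ∀ n → Unique (allPerms n)
allPerms-! n = mapMaybe-mkPerm?-! (permWords-! n)

∈-allPerms : ∀ {n} u → size u ≡ n → u ∈ allPerms n
∈-allPerms u refl = ∈-mapMaybe-mkPerm?⁺ (permWords (size u)) u (∈-permWords⁺ (size u) (word-↭ u))

-- The weak order and inversion sets

𝟙 : Bool → ℕ
𝟙 b = if b then 1 else 0

-- The first argument of `h` comes from the earlier position; with the indicator of a drop in value
-- as `h` this is `invW`.
pairSum : (A → A → ℕ) → List A → ℕ
pairSum h []       = 0
pairSum h (x ∷ xs) = sum (map (h x) xs) + pairSum h xs

sum-cong-All : ∀ {f g : A → ℕ} {xs} → All (λ a → f a ≡ g a) xs → sum (map f xs) ≡ sum (map g xs)
sum-cong-All []       = refl
sum-cong-All (p ∷ ps) = cong₂ _+_ p (sum-cong-All ps)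

pairSum-cong : ∀ {h k : A → A → ℕ} {xs} → AllPairs (λ a b → h a b ≡ k a b) xs → pairSum h xs ≡ pairSum k xs
pairSum-cong []       = refl
pairSum-cong (p ∷ ps) = cong₂ _+_ (sum-cong-All p) (pairSum-cong ps)

sum-map-+ : ∀ (f g : A → ℕ) xs → sum (map (λ a → f a + g a) xs) ≡ sum (map f xs) + sum (map g xs)
sum-map-+ f g []       = refl
sum-map-+ f g (x ∷ xs) = trans (cong (f x + g x +_) (sum-map-+ f g xs))
  (solve 4 (λ a b c d → a :+ b :+ (c :+ d) := a :+ c :+ (b :+ d)) refl (f x) (g x) (sum (map f xs)) (sum (map g xs)))
  where open ℕ-Solver

pairSum-+ : ∀ (h k : A → A → ℕ) xs → pairSum (λ a b → h a b + k a b) xs ≡ pairSum h xs + pairSum k xs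
pairSum-+ h k []       = refl
pairSum-+ h k (x ∷ xs) = trans (cong₂ _+_ (sum-map-+ (h x) (k x) xs) (pairSum-+ h k xs))
  (solve 4 (λ a b c d → a :+ b :+ (c :+ d) := a :+ c :+ (b :+ d)) refl
    (sum (map (h x) xs)) (sum (map (k x) xs)) (pairSum h xs) (pairSum k xs))
  where open ℕ-Solver

pairSum-map : ∀ (h : B → B → ℕ) (g : A → B) xs → pairSum h (map g xs) ≡ pairSum (λ a b → h (g a) (g b)) xs
pairSum-map h g []       = refl
pairSum-map h g (x ∷ xs) = cong₂ _+_ (cong sum (sym (List.map-∘ xs))) (pairSum-map h g xs)

sum-map-↭ : ∀ (f : A → ℕ) {xs ys} → xs ↭ ys → sum (map f xs) ≡ sum (map f ys)
sum-map-↭ f ↭.refl         = refl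
sum-map-↭ f (prep x p)   = cong (f x +_) (sum-map-↭ f p)
sum-map-↭ f (swap {xs = xs} {ys} x y p) = trans
  (solve 3 (λ a b c → a :+ (b :+ c) := b :+ (a :+ c)) refl (f x) (f y) (sum (map f xs)))
  (cong (λ t → f y + (f x + t)) (sum-map-↭ f p))
  where open ℕ-Solver
sum-map-↭ f (↭.trans p q)  = trans (sum-map-↭ f p) (sum-map-↭ f q)

-- Rearranging a list only turns some pairs around, which a symmetric `h` does not notice.
pairSum-↭ : ∀ {h : A → A → ℕ} → (∀ a b → h a b ≡ h b a) → ∀ {xs ys} → xs ↭ ys → pairSum h xs ≡ pairSum h ys
pairSum-↭ s ↭.refl = refl
pairSum-↭ {h = h} s (prep x p) = cong₂ _+_ (sum-map-↭ (h x) p) (pairSum-↭ s p)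
pairSum-↭ {h = h} s (swap {xs = xs} {ys} x y p) = trans
  (solve 4 (λ a b c d → a :+ b :+ (c :+ d) := a :+ c :+ (b :+ d)) refl
    (h x y) (sum (map (h x) xs)) (sum (map (h y) xs)) (pairSum h xs))
  (cong₂ _+_ (cong₂ _+_ (s x y) (sum-map-↭ (h y) p)) (cong₂ _+_ (sum-map-↭ (h x) p) (pairSum-↭ s p)))
  where open ℕ-Solver
pairSum-↭ s (↭.trans p q) = trans (pairSum-↭ s p) (pairSum-↭ s q)

sum≡0 : ∀ (f : A → ℕ) xs → sum (map f xs) ≡ 0 → All (λ a → f a ≡ 0) xs
sum≡0 f []       e = []
sum≡0 f (x ∷ xs) e = ℕ.m+n≡0⇒m≡0 (f x) e ∷ sum≡0 f xs (ℕ.m+n≡0⇒n≡0 (f x) e)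

pairSum≡0 : ∀ (h : A → A → ℕ) xs → pairSum h xs ≡ 0 → AllPairs (λ a b → h a b ≡ 0) xs
pairSum≡0 h []       e = []
pairSum≡0 h (x ∷ xs) e = sum≡0 (h x) xs (ℕ.m+n≡0⇒m≡0 _ e) ∷ pairSum≡0 h xs (ℕ.m+n≡0⇒n≡0 (sum (map (h x) xs)) e)

pairSum-zero : ∀ {h : A → A → ℕ} {xs} → AllPairs (λ a b → h a b ≡ 0) xs → pairSum h xs ≡ 0
pairSum-zero []       = refl
pairSum-zero (p ∷ ps) = cong₂ _+_ (zeros p) (pairSum-zero ps)
  where
  zeros : ∀ {f : A → ℕ} {xs} → All (λ a → f a ≡ 0) xs → sum (map f xs) ≡ 0
  zeros []       = refl
  zeros (q ∷ qs) = cong₂ _+_ q (zeros qs)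

cnt-sum : ∀ x xs → cnt x xs ≡ sum (map (λ y → 𝟙 (y <ᵇ x)) xs)
cnt-sum x [] = refl
cnt-sum x (y ∷ ys) with y <ᵇ x
... | true  = cong suc (cnt-sum x ys)
... | false = cnt-sum x ys

invW-pairSum : ∀ xs → invW xs ≡ pairSum (λ a b → 𝟙 (b <ᵇ a)) xs
invW-pairSum []       = refl
invW-pairSum (x ∷ xs) = cong₂ _+_ (cnt-sum x xs) (invW-pairSum xs)

<ᵇ-true : ∀ {a b} → a < b → (a <ᵇ b) ≡ true
<ᵇ-true a<b = Equivalence.to T-≡ (ℕ.<⇒<ᵇ a<b)

<ᵇ-false : ∀ {a b} → b < a → (a <ᵇ b) ≡ false
<ᵇ-false {a} {b} b<a = ¬-not (λ e → ℕ.<-asym b<a (ℕ.<ᵇ⇒< a b (Equivalence.from T-≡ e)))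

module _ (g : ℕ → ℕ) where

  flips : ℕ → ℕ → ℕ
  flips a b = 𝟙 ((b <ᵇ a) ∧ (g a <ᵇ g b))

  -- inv (w u) + 2 K = inv w + inv u, where K counts the inversions of u that w undoes.
  invW-map : ∀ {xs n} → xs ↭ range1 n → Unique (map g xs) →
    invW (map g xs) + (pairSum flips xs + pairSum flips xs) ≡ invW (map g (range1 n)) + invW xs
  invW-map {xs} {n} p u = begin
    invW (map g xs) + (pairSum flips xs + pairSum flips xs)
      ≡⟨ cong₂ _+_ (trans (invW-pairSum (map g xs)) (pairSum-map _ g xs)) (sym (pairSum-+ flips flips xs)) ⟩
    pairSum (λ a b → 𝟙 (g b <ᵇ g a)) xs + pairSum (λ a b → flips a b + flips a b) xs
      ≡⟨ pairSum-+ _ _ xs ⟨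
    pairSum (λ a b → 𝟙 (g b <ᵇ g a) + (flips a b + flips a b)) xs
      -- Checked for one pair at a time, over the four combinations of the order of a, b and the
      -- order of g a, g b.
      ≡⟨ pairSum-cong (AllPairs.map (λ (a≢b , ga≢gb) → pointwise a≢b ga≢gb)
           (AllPairs.zip (Unique-resp-↭ (↭-sym p) (range1-! n) , AllPairs.map⁻ u))) ⟩
    pairSum (λ a b → (flips a b + flips b a) + 𝟙 (b <ᵇ a)) xs
      ≡⟨ pairSum-+ _ _ xs ⟩
    pairSum (λ a b → flips a b + flips b a) xs + pairSum (λ a b → 𝟙 (b <ᵇ a)) xs
      -- `flips a b + flips b a` tells whether g reverses the values a and b, whichever comes first.
      -- Being symmetric, it may be summed over the increasing list instead, where it counts the
      -- inversions of g.
      ≡⟨ cong₂ _+_ (pairSum-↭ (λ a b → ℕ.+-comm (flips a b) (flips b a)) p) (sym (invW-pairSum xs)) ⟩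
    pairSum (λ a b → flips a b + flips b a) (range1 n) + invW xs
      ≡⟨ cong (_+ invW xs) (pairSum-cong (AllPairs.map sorted range1-↗)) ⟩
    pairSum (λ a b → 𝟙 (g b <ᵇ g a)) (range1 n) + invW xs
      ≡⟨ cong (_+ invW xs) (trans (invW-pairSum (map g (range1 n))) (pairSum-map _ g (range1 n))) ⟨
    invW (map g (range1 n)) + invW xs ∎
    where
    open ≡-Reasoning
    range1-↗ : AllPairs _<_ (range1 n)
    range1-↗ = subst (AllPairs _<_) (sym (range1≡ n)) (AllPairs.applyUpTo⁺₁ suc n (λ i<j _ → s≤s i<j))
    sorted : ∀ {a b} → a < b → flips a b + flips b a ≡ 𝟙 (g b <ᵇ g a)
    sorted {a} {b} a<b rewrite <ᵇ-true a<b | <ᵇ-false a<b = refl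
    pointwise : ∀ {a b} → a ≢ b → g a ≢ g b →
      𝟙 (g b <ᵇ g a) + (flips a b + flips a b) ≡ (flips a b + flips b a) + 𝟙 (b <ᵇ a)
    pointwise {a} {b} ne ne′ with ℕ.<-cmp a b | ℕ.<-cmp (g a) (g b)
    ... | tri≈ _ e _ | _ = contradiction e ne
    ... | tri< _ _ _ | tri≈ _ e _ = contradiction e ne′
    ... | tri> _ _ _ | tri≈ _ e _ = contradiction e ne′
    ... | tri< l _ _ | tri< m _ _ rewrite <ᵇ-true l | <ᵇ-false l | <ᵇ-false m = refl
    ... | tri< l _ _ | tri> _ _ m rewrite <ᵇ-true l | <ᵇ-false l | <ᵇ-true m = refl
    ... | tri> _ _ l | tri< m _ _ rewrite <ᵇ-true l | <ᵇ-false l | <ᵇ-true m | <ᵇ-false m = refl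
    ... | tri> _ _ l | tri> _ _ m rewrite <ᵇ-true l | <ᵇ-false l | <ᵇ-true m | <ᵇ-false m = refl

  PreservesInversions : List ℕ → Set
  PreservesInversions = AllPairs (λ a b → b < a → g b < g a)

  -- Additivity reduces `invW-map` to 2 K = 0, so every summand of K vanishes; distinct images
  -- exclude the remaining case g a = g b.
  invW-additive⇒preserves : ∀ {xs n} → xs ↭ range1 n → Unique (map g xs) →
    invW (map g xs) ≡ invW (map g (range1 n)) + invW xs → PreservesInversions xs
  invW-additive⇒preserves {xs} {n} p u e =
    AllPairs.map (λ (z , ne) → unflipped z ne) (AllPairs.zip (pairSum≡0 flips xs none , AllPairs.map⁻ u))
    where
    none : pairSum flips xs ≡ 0
    none = ℕ.m+n≡0⇒m≡0 _ (ℕ.+-cancelˡ-≡ (invW (map g xs)) _ 0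
      (trans (invW-map p u) (trans (sym e) (sym (ℕ.+-identityʳ _)))))
    unflipped : ∀ {a b} → flips a b ≡ 0 → g a ≢ g b → b < a → g b < g a
    unflipped {a} {b} z ne b<a with ℕ.<-cmp (g a) (g b)
    ... | tri≈ _ e _ = contradiction e ne
    ... | tri> _ _ m = m
    ... | tri< m _ _ rewrite <ᵇ-true b<a | <ᵇ-true m with () ← z

  preserves⇒invW-additive : ∀ {xs n} → xs ↭ range1 n → Unique (map g xs) → PreservesInversions xs →
    invW (map g xs) ≡ invW (map g (range1 n)) + invW xs
  preserves⇒invW-additive {xs} {n} p u pr = trans (sym (ℕ.+-identityʳ _)) (trans
    (cong (λ k → invW (map g xs) + (k + k)) (sym (pairSum-zero (AllPairs.map zero-flip pr)))) (invW-map p u))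
    where
    zero-flip : ∀ {a b} → (b < a → g b < g a) → flips a b ≡ 0
    zero-flip {a} {b} f with b <ᵇ a in eq
    ... | false = refl
    ... | true rewrite <ᵇ-false (f (ℕ.<ᵇ⇒< b a (Equivalence.from T-≡ eq))) = refl

-- Inclusion of the inversion sets of two words, inversions being pairs of positions.
infix 4 _⊑_
data _⊑_ : List ℕ → List ℕ → Set where
  []  : [] ⊑ []
  _∷_ : ∀ {x y xs ys} → Pointwise (λ a b → a < x → b < y) xs ys → xs ⊑ ys → x ∷ xs ⊑ y ∷ ys

⊑-length : ∀ {xs ys} → xs ⊑ ys → length xs ≡ length ys
⊑-length []       = refl
⊑-length (p ∷ ps) = cong suc (⊑-length ps)

⊑-refl : ∀ {xs} → xs ⊑ xs
⊑-refl {[]}     = []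
⊑-refl {x ∷ xs} = Pointwise.refl id ∷ ⊑-refl

⊑-trans : ∀ {xs ys zs} → xs ⊑ ys → ys ⊑ zs → xs ⊑ zs
⊑-trans []       []       = []
⊑-trans (p ∷ ps) (q ∷ qs) = Pointwise.transitive (λ f g → g ∘ f) p q ∷ ⊑-trans ps qs

Pointwise-mapʳ⁺ : ∀ {R : A → B → Set} {g : A → B} {xs} → All (λ a → R a (g a)) xs → Pointwise R xs (map g xs)
Pointwise-mapʳ⁺ []       = []
Pointwise-mapʳ⁺ (p ∷ ps) = p ∷ Pointwise-mapʳ⁺ ps

Pointwise-mapʳ⁻ : ∀ {R : A → B → Set} {g : A → B} xs → Pointwise R xs (map g xs) → All (λ a → R a (g a)) xs
Pointwise-mapʳ⁻ []       []       = []
Pointwise-mapʳ⁻ (x ∷ xs) (p ∷ ps) = p ∷ Pointwise-mapʳ⁻ xs ps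

preserves⇒⊑ : ∀ {g xs} → PreservesInversions g xs → xs ⊑ map g xs
preserves⇒⊑ []       = []
preserves⇒⊑ (p ∷ ps) = Pointwise-mapʳ⁺ p ∷ preserves⇒⊑ ps

⊑⇒preserves : ∀ {g} xs → xs ⊑ map g xs → PreservesInversions g xs
⊑⇒preserves []       []       = []
⊑⇒preserves (x ∷ xs) (p ∷ ps) = Pointwise-mapʳ⁻ xs p ∷ ⊑⇒preserves xs ps

Pointwise-map-local : ∀ {R S : A → B → Set} {xs ys} → (∀ {a b} → a ∈ xs → R a b → S a b) →
  Pointwise R xs ys → Pointwise S xs ys
Pointwise-map-local f []       = []
Pointwise-map-local f (r ∷ rs) = f (here refl) r ∷ Pointwise-map-local (f ∘ there) rs

-- The left word sits in the premise of an implication: introducing a relabelling there requires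
-- that it reflect `<`, whereas on the right it must preserve `<`. Removing it exchanges the two
-- conditions.
⊑-mapˡ⁺ : ∀ {f : ℕ → ℕ} {xs ys} → (∀ {a b} → f a < f b → a < b) → xs ⊑ ys → map f xs ⊑ ys
⊑-mapˡ⁺ m [] = []
⊑-mapˡ⁺ {f} {x ∷ xs} {y ∷ ys} m (p ∷ ps) =
  subst (Pointwise _ (map f xs)) (List.map-id ys) (Pointwise.map⁺ f id (Pointwise.map (λ h l → h (m l)) p))
  ∷ ⊑-mapˡ⁺ m ps

-- Monotonicity is asked only at letters of `xs` because a rank grows strictly from `a` to a larger
-- number only if `a` itself is a letter to be counted.
⊑-mapˡ⁻ : ∀ {f : ℕ → ℕ} {xs ys} → (∀ {a b} → a ∈ xs → a < b → f a < f b) → map f xs ⊑ ys → xs ⊑ ys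
⊑-mapˡ⁻ {f} {[]} {[]} m [] = []
⊑-mapˡ⁻ {f} {x ∷ xs} {y ∷ ys} m (p ∷ ps) =
  Pointwise-map-local (λ a∈ h l → h (m (there a∈) l))
    (Pointwise.map⁻ f id (subst (Pointwise _ (map f xs)) (sym (List.map-id ys)) p))
  ∷ ⊑-mapˡ⁻ (m ∘ there) ps

⊑-mapʳ⁺ : ∀ {f : ℕ → ℕ} {xs ys} → (∀ {a b} → a < b → f a < f b) → xs ⊑ ys → xs ⊑ map f ys
⊑-mapʳ⁺ m [] = []
⊑-mapʳ⁺ {f} {x ∷ xs} {y ∷ ys} m (p ∷ ps) =
  subst (λ zs → Pointwise _ zs (map f ys)) (List.map-id xs)
    (Pointwise.map⁺ id f (Pointwise.map (λ h l → m (h l)) p))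
  ∷ ⊑-mapʳ⁺ m ps

⊑-mapʳ⁻ : ∀ {f : ℕ → ℕ} {xs ys} → (∀ {a b} → f a < f b → a < b) → xs ⊑ map f ys → xs ⊑ ys
⊑-mapʳ⁻ {f} {[]} {[]} m [] = []
⊑-mapʳ⁻ {f} {x ∷ xs} {y ∷ ys} m (p ∷ ps) =
  Pointwise.map (λ h l → m (h l)) (Pointwise.map⁻ id f
    (subst (λ zs → Pointwise _ zs (map f ys)) (sym (List.map-id xs)) p))
  ∷ ⊑-mapʳ⁻ m ps

stW-⊑⁺ : ∀ {x y} → x ⊑ y → stW x ⊑ y
stW-⊑⁺ {x} = ⊑-mapˡ⁺ (λ {a} {b} l → ℕ.≰⇒> (λ b≤a → ℕ.<-irrefl refl (ℕ.<-≤-trans l (s≤s (cnt-mono-≤ x b≤a)))))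

stW-⊑⁻ : ∀ {x y} → stW x ⊑ y → x ⊑ y
stW-⊑⁻ {x} = ⊑-mapˡ⁻ (λ a∈ l → s≤s (cnt-mono-< a∈ l))

Pointwise-++⁻ : ∀ {R : A → B → Set} xs ys {xs′ ys′} → length xs ≡ length ys →
  Pointwise R (xs ++ xs′) (ys ++ ys′) → Pointwise R xs ys × Pointwise R xs′ ys′
Pointwise-++⁻ []       []       e p = [] , p
Pointwise-++⁻ (x ∷ xs) (y ∷ ys) e (r ∷ rs) with p , q ← Pointwise-++⁻ xs ys (ℕ.suc-injective e) rs = r ∷ p , q

⊑-++⁻ : ∀ xs ys {xs′ ys′} → length xs ≡ length ys → xs ++ xs′ ⊑ ys ++ ys′ → xs ⊑ ys × xs′ ⊑ ys′
⊑-++⁻ []       []       e p = [] , p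
⊑-++⁻ (x ∷ xs) (y ∷ ys) e (r ∷ rs) with p , q ← ⊑-++⁻ xs ys (ℕ.suc-injective e) rs =
  proj₁ (Pointwise-++⁻ xs ys (ℕ.suc-injective e) r) ∷ p , q

⊑-++⁺ : ∀ {xs ys xs′ ys′} → All (λ y → All (_< y) ys′) ys → xs ⊑ ys → xs′ ⊑ ys′ → xs ++ xs′ ⊑ ys ++ ys′
⊑-++⁺ []       []       q = q
⊑-++⁺ {ys′ = ys′} (c ∷ cs) (p ∷ ps) q = Pointwise.++⁺ p (const (⊑-length q) c) ∷ ⊑-++⁺ cs ps q
  where
  const : ∀ {xs ys x y} → length xs ≡ length ys → All (_< y) ys → Pointwise (λ a b → a < x → b < y) xs ys
  const {[]}     {[]}     e []       = []
  const {x ∷ xs} {y ∷ ys} e (l ∷ ls) = (λ _ → l) ∷ const (ℕ.suc-injective e) ls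

map-at-range1 : ∀ w → map (at w) (range1 (length w)) ≡ w
map-at-range1 w = trans (cong (map (at w)) (range1≡ (length w)))
  (trans (List.map-applyUpTo suc (at w) (length w)) (entries w))
  where
  entries : ∀ w → applyUpTo (λ i → at w (suc i)) (length w) ≡ w
  entries []       = refl
  entries (x ∷ xs) = cong (x ∷_) (entries xs)

map-≡⇒≡ : ∀ {f g : A → B} xs → map f xs ≡ map g xs → ∀ {a} → a ∈ xs → f a ≡ g a
map-≡⇒≡ (x ∷ xs) e (here refl) = List.∷-injectiveˡ e
map-≡⇒≡ (x ∷ xs) e (there a∈)  = map-≡⇒≡ xs (List.∷-injectiveʳ e) a∈

map-cong-∈ : ∀ {f g : A → B} {xs} → (∀ {a} → a ∈ xs → f a ≡ g a) → map f xs ≡ map g xs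
map-cong-∈ e = List.map-cong-local (All.tabulate e)

-- For the words of u and v this table is the permutation v u⁻¹, obtained without inverting u. The
-- default 0 is returned only off the letters of u.
assoc : List ℕ → List ℕ → ℕ → ℕ
assoc (x ∷ xs) (y ∷ ys) i with i ℕ.≟ x
... | yes _ = y
... | no  _ = assoc xs ys i
assoc _ _ i = 0

map-assoc : ∀ {xs ys} → Unique xs → length xs ≡ length ys → map (assoc xs ys) xs ≡ ys
map-assoc {[]}     {[]}     u e = refl
map-assoc {x ∷ xs} {y ∷ ys} (px ∷ u) e = cong₂ _∷_ hd
  (trans (map-cong-∈ tl) (map-assoc u (ℕ.suc-injective e)))
  where
  hd : assoc (x ∷ xs) (y ∷ ys) x ≡ y
  hd with x ℕ.≟ x
  ... | yes _ = refl
  ... | no ne = contradiction refl ne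
  tl : ∀ {a} → a ∈ xs → assoc (x ∷ xs) (y ∷ ys) a ≡ assoc xs ys a
  tl {a} a∈ with a ℕ.≟ x
  ... | yes refl = contradiction refl (All.lookup px a∈)
  ... | no _ = refl

-- The weak order as a partial order compatible with ⊹

infix 4 _≼_
record _≼_ (u v : Perm) : Set where
  constructor holds
  field isWeakLe : T (weakLeᵇ u v)

_≼?_ : ∀ u v → Dec (u ≼ v)
u ≼? v = map′ holds _≼_.isWeakLe (T? (weakLeᵇ u v))

≼-size : ∀ {u v} → u ≼ v → size u ≡ size v
≼-size {u} {v} (holds l) = ℕ.≡ᵇ⇒≡ (size u) (size v) (proj₁ (Equivalence.to T-∧ l))

∈-allPerms⁻ : ∀ {n u} → u ∈ allPerms n → size u ≡ n
∈-allPerms⁻ {n} u∈ = trans (↭-length (∈-permWords⁻ n (∈-mapMaybe-mkPerm? (permWords n) u∈))) (length-range1 n)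

≼-witness : ∀ {u v} → u ≼ v → ∃ λ w → size w ≡ size u × map (at (word w)) (word u) ≡ word v × ℓ v ≡ ℓ w + ℓ u
≼-witness {u} {v} (holds l)
  with w , w∈ , t ← find (Any.any⁻ _ (allPerms (size u)) (proj₂ (Equivalence.to (T-∧ {size u ℕ.≡ᵇ size v}) l))) =
  w , ∈-allPerms⁻ w∈ , toWitness (proj₁ (Equivalence.to (T-∧ {eqWᵇ (compose (word w) (word u)) (word v)}) t)) ,
  ℕ.≡ᵇ⇒≡ (ℓ v) (ℓ w + ℓ u) (proj₂ (Equivalence.to (T-∧ {eqWᵇ (compose (word w) (word u)) (word v)}) t))

≼⇒⊑ : ∀ {u v} → u ≼ v → word u ⊑ word v
≼⇒⊑ {u} {v} l with w , sw , e , ℓ≡ ← ≼-witness l =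
  subst (word u ⊑_) e (preserves⇒⊑ (invW-additive⇒preserves (at (word w)) (word-↭ u)
    (subst Unique (sym e) (word-! v))
    (trans (cong invW e) (trans ℓ≡ (cong (λ z → invW z + ℓ u)
      (sym (trans (cong (λ n → map (at (word w)) (range1 n)) (sym sw)) (map-at-range1 (word w)))))))))

-- The witness is forced to be w = v u⁻¹. Inclusion of inversion sets says that w undoes no
-- inversion of u, and then the lengths add.
⊑⇒≼ : ∀ {u v} → word u ⊑ word v → u ≼ v
⊑⇒≼ {u} {v} l = holds (Equivalence.from T-∧ (ℕ.≡⇒≡ᵇ (size u) (size v) n≡ , Any.any⁺ _
  (Any.map (λ { refl → Equivalence.from T-∧ (fromWitness w∘u , ℕ.≡⇒≡ᵇ (ℓ v) (ℓ w + ℓ u) ℓ≡) }) (∈-allPerms w len))))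
  where
  n≡ : size u ≡ size v
  n≡ = ⊑-length l
  r : List ℕ
  r = range1 (size u)
  g : ℕ → ℕ
  g = assoc (word u) (word v)
  g-u : map g (word u) ≡ word v
  g-u = map-assoc (word-! u) n≡
  len′ : length (map g r) ≡ size u
  len′ = trans (List.length-map g r) (length-range1 (size u))
  -- Along the word of u, an arrangement of 1, ..., n, the values of `g` form the word of v; so on
  -- 1, ..., n they are a rearrangement of it.
  w : Perm
  w = perm (map g r) (IsPermWord⇒T (↭-trans (↭-map⁺ g (↭-sym (word-↭ u))) (↭-trans (↭-reflexive g-u)
        (↭-trans (word-↭ v) (↭-reflexive (cong range1 (trans (sym n≡) (sym len′))))))))
  len : size w ≡ size u
  len = len′
  at-w : ∀ {i} → i ∈ r → at (map g r) i ≡ g i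
  at-w = map-≡⇒≡ r (trans (cong (λ n → map (at (map g r)) (range1 n)) (sym len′)) (map-at-range1 (map g r)))
  w∘u : compose (map g r) (word u) ≡ word v
  w∘u = trans (map-cong-∈ (λ i∈ → at-w (∈-resp-↭ (word-↭ u) i∈))) g-u
  ℓ≡ : ℓ v ≡ ℓ w + ℓ u
  ℓ≡ = trans (cong invW (sym g-u)) (preserves⇒invW-additive g (word-↭ u) (subst Unique (sym g-u) (word-! v))
         (⊑⇒preserves (word u) (subst (word u ⊑_) (sym g-u) l)))

≼-refl : ∀ u → u ≼ u
≼-refl u = ⊑⇒≼ ⊑-refl

≼-trans : ∀ {u v w} → u ≼ v → v ≼ w → u ≼ w
≼-trans {u} {v} {w} p q = ⊑⇒≼ (⊑-trans (≼⇒⊑ p) (≼⇒⊑ q))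

≼⇒ℓ≤ : ∀ {u v} → u ≼ v → ℓ u ≤ ℓ v
≼⇒ℓ≤ {u} {v} l with w , _ , _ , e ← ≼-witness l = subst (ℓ u ≤_) (sym e) (ℕ.m≤n+m (ℓ u) (ℓ w))

↗-↭⇒≡ : ∀ {xs ys} → AllPairs _≤_ xs → AllPairs _≤_ ys → xs ↭ ys → xs ≡ ys
↗-↭⇒≡ {[]}     {[]}     _ _ _ = refl
↗-↭⇒≡ {[]}     {_ ∷ _}  _ _ p with () ← ↭-length p
↗-↭⇒≡ {_ ∷ _}  {[]}     _ _ p with () ← ↭-length p
↗-↭⇒≡ {x ∷ xs} {y ∷ ys} (px ∷ s) (py ∷ t) p with x≡y
  where
  bound : ∀ {x y ys} → All (y ≤_) ys → x ∈ y ∷ ys → y ≤ x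
  bound py (here refl) = ℕ.≤-refl
  bound py (there x∈)  = All.lookup py x∈
  x≡y : x ≡ y
  x≡y = ℕ.≤-antisym (bound px (∈-resp-↭ (↭-sym p) (here refl))) (bound py (∈-resp-↭ p (here refl)))
... | refl = cong (x ∷_) (↗-↭⇒≡ s t (drop-∷ p))

range1-≤ : ∀ n → AllPairs _≤_ (range1 n)
range1-≤ n = subst (AllPairs _≤_) (sym (range1≡ n)) (AllPairs.applyUpTo⁺₁ suc n (λ i<j _ → ℕ.<⇒≤ (s≤s i<j)))

invW≡0 : ∀ {w} → IsPermWord w → invW w ≡ 0 → w ≡ range1 (length w)
invW≡0 {w} p e = ↗-↭⇒≡ (AllPairs.map ascent (pairSum≡0 _ w (trans (sym (invW-pairSum w)) e))) (range1-≤ (length w)) p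
  where
  ascent : ∀ {a b} → 𝟙 (b <ᵇ a) ≡ 0 → a ≤ b
  ascent {a} {b} z = ℕ.≮⇒≥ (λ b<a → case subst (λ t → 𝟙 t ≡ 0) (<ᵇ-true b<a) z of λ ())

-- Equal lengths leave length 0 for the witness w; a word without inversions is sorted, so w is the
-- identity. Antisymmetry and strict growth of `ℓ` follow.
≼∧ℓ≡⇒≡ : ∀ {u v} → u ≼ v → ℓ u ≡ ℓ v → u ≡ v
≼∧ℓ≡⇒≡ {u} {v} l e with w , sw , wu , ℓ≡ ← ≼-witness l = word-injective (begin
  word u                       ≡⟨ List.map-id (word u) ⟨
  map id (word u)              ≡⟨ map-cong-∈ (λ i∈ → sym (fixed (∈-resp-↭ (word-↭ u) i∈))) ⟩
  map (at (word w)) (word u)   ≡⟨ wu ⟩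
  word v                       ∎)
  where
  open ≡-Reasoning
  w≡id : word w ≡ range1 (size u)
  w≡id = trans (invW≡0 (word-↭ w) (ℕ.+-cancelʳ-≡ (ℓ u) _ 0 (trans (sym ℓ≡) (sym e)))) (cong range1 sw)
  fixed : ∀ {i} → i ∈ range1 (size u) → at (word w) i ≡ i
  fixed = map-≡⇒≡ (range1 (size u)) (begin
    map (at (word w)) (range1 (size u)) ≡⟨ cong (λ n → map (at (word w)) (range1 n)) sw ⟨
    map (at (word w)) (range1 (size w)) ≡⟨ map-at-range1 (word w) ⟩
    word w                              ≡⟨ w≡id ⟩
    range1 (size u)                     ≡⟨ List.map-id _ ⟨
    map id (range1 (size u))            ∎)

≼-antisym : ∀ {u v} → u ≼ v → v ≼ u → u ≡ v
≼-antisym {u} {v} p q = ≼∧ℓ≡⇒≡ p (ℕ.≤-antisym (≼⇒ℓ≤ p) (≼⇒ℓ≤ q))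

≼-strict : ∀ {u v} → u ≼ v → u ≢ v → ℓ u < ℓ v
≼-strict {u} {v} p ne = ℕ.≤∧≢⇒< (≼⇒ℓ≤ p) (ne ∘ ≼∧ℓ≡⇒≡ p)

-- A crude bound is enough: it only has to stop the upward recursion in `M-separates`.
ℓ-bound : ∀ u → ℓ u ≤ size u ℕ.* size u
ℓ-bound u = bound (word u)
  where
  bound : ∀ w → invW w ≤ length w ℕ.* length w
  bound []       = z≤n
  bound (x ∷ w) = ℕ.+-mono-≤ (ℕ.m≤n⇒m≤1+n (List.length-filter (_<? x) w))
    (ℕ.≤-trans (bound w) (ℕ.*-monoʳ-≤ (length w) (ℕ.n≤1+n (length w))))

take-! : ∀ u p → Unique (take p (word u))
take-! u p = Unique.take⁺ p (word-! u)

drop-! : ∀ u p → Unique (drop p (word u))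
drop-! u p = Unique.drop⁺ p (word-! u)

⊹-globalDesc : ∀ a b → All (λ y → All (_< y) (word b)) (map (size b +_) (word a))
⊹-globalDesc a b = All.map⁺ (All.tabulate (λ {y} y∈ → All.tabulate (λ z∈ →
  ℕ.≤-<-trans (proj₂ (word-bounds b z∈)) (ℕ.m<m+n (size b) (proj₁ (word-bounds a y∈))))))

-- Standardising the two parts of u and undoing the shift of a are order-preserving relabellings, so
-- inclusion of inversion sets can be read off on either side of the cut.
≼-⊹⁻ : ∀ {u a b} → u ≼ a ⊹ b → size u ≡ size a + size b ×
  st (take (size a) (word u)) ≼ a × st (drop (size a) (word u)) ≼ b
≼-⊹⁻ {u} {a} {b} l = su ,
  ⊑⇒≼ (subst (_⊑ word a) (sym (st-word (take-! u (size a))))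
    (stW-⊑⁺ (⊑-mapʳ⁻ (ℕ.+-cancelˡ-< (size b) _ _) (proj₁ split)))) ,
  ⊑⇒≼ (subst (_⊑ word b) (sym (st-word (drop-! u (size a)))) (stW-⊑⁺ (proj₂ split)))
  where
  x y : List ℕ
  x = take (size a) (word u)
  y = drop (size a) (word u)
  su : size u ≡ size a + size b
  su = trans (≼-size l) (size-⊹ a b)
  lenx : length x ≡ length (map (size b +_) (word a))
  lenx = trans (List.length-take (size a) (word u)) (trans
    (ℕ.m≤n⇒m⊓n≡m (subst (size a ≤_) (sym su) (ℕ.m≤m+n (size a) (size b)))) (sym (List.length-map _ (word a))))
  split : x ⊑ map (size b +_) (word a) × y ⊑ word b
  split = ⊑-++⁻ x _ lenx (subst (_⊑ word (a ⊹ b)) (sym (List.take++drop≡id (size a) (word u))) (≼⇒⊑ l))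

≼-⊹⁺ : ∀ {u a b} → st (take (size a) (word u)) ≼ a → st (drop (size a) (word u)) ≼ b → u ≼ a ⊹ b
≼-⊹⁺ {u} {a} {b} p q = ⊑⇒≼ (subst (_⊑ word (a ⊹ b)) (List.take++drop≡id (size a) (word u))
  (⊑-++⁺ (⊹-globalDesc a b)
    (⊑-mapʳ⁺ (ℕ.+-monoʳ-< (size b)) (stW-⊑⁻ (subst (_⊑ word a) (st-word (take-! u (size a))) (≼⇒⊑ p))))
    (stW-⊑⁻ (subst (_⊑ word b) (st-word (drop-! u (size a))) (≼⇒⊑ q)))))

-- Möbius inversion

open ℚ-Solver using (solve; _:=_; _:+_; _:*_; :-_; con)

⟦⟧-true : ∀ {b} → T b → ⟦ b ⟧ ≡ 1ℚ
⟦⟧-true {true} _ = refl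

⟦⟧-false : ∀ {b} → ¬ T b → ⟦ b ⟧ ≡ 0ℚ
⟦⟧-false {true}  t = contradiction _ t
⟦⟧-false {false} _ = refl

*-vanishˡ : ∀ {p} q → p ≡ 0ℚ → p ℚ.* q ≡ 0ℚ
*-vanishˡ q refl = ℚ.*-zeroˡ q

*-vanishʳ : ∀ p {q} → q ≡ 0ℚ → p ℚ.* q ≡ 0ℚ
*-vanishʳ p refl = ℚ.*-zeroʳ p

abstract
  -- The zeta function of the weak order, to which μ is inverse in the incidence algebra.
  ζ : Perm → Perm → ℚ
  ζ u v = ⟦ weakLeᵇ u v ⟧

  ζ-⟦⟧ : ∀ u v → ζ u v ≡ ⟦ weakLeᵇ u v ⟧
  ζ-⟦⟧ u v = refl

ζ-≼ : ∀ {u v} → u ≼ v → ζ u v ≡ 1ℚ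
ζ-≼ {u} {v} l = trans (ζ-⟦⟧ u v) (⟦⟧-true (_≼_.isWeakLe l))

ζ-⋠ : ∀ {u v} → ¬ u ≼ v → ζ u v ≡ 0ℚ
ζ-⋠ {u} {v} ¬l = trans (ζ-⟦⟧ u v) (⟦⟧-false (¬l ∘ holds))

intervalᵇ : Perm → Perm → Perm → Bool
intervalᵇ u v w = weakLeᵇ u w ∧ weakLeᵇ w v ∧ not (eqWᵇ (word w) (word v))

interval : Perm → Perm → List Perm
interval u v = filter (λ w → T? (intervalᵇ u v w)) (allPerms (size v))

intervalᵇ⁻ : ∀ {u v w} → T (intervalᵇ u v w) → u ≼ w × w ≼ v × w ≢ v
intervalᵇ⁻ {u} {v} {w} t with p , q ← Equivalence.to (T-∧ {weakLeᵇ u w}) t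
  with r , s ← Equivalence.to (T-∧ {weakLeᵇ w v}) q = holds p , holds r , λ e → toWitnessFalse s (cong word e)

∈-interval⁻ : ∀ {u v w} → w ∈ interval u v → u ≼ w × w ≼ v × w ≢ v
∈-interval⁻ {u} {v} {w} w∈ =
  intervalᵇ⁻ {u} {v} {w} (proj₂ (∈-filter⁻ (λ w → T? (intervalᵇ u v w)) {xs = allPerms (size v)} w∈))

-- Each recursive call moves the upper end strictly down, which lowers `ℓ v ∸ ℓ u`. Independence of
-- the fuel is needed because the call at w inside `μ u v` carries the fuel of v, not the one that
-- `μ u w` would use.
möbF-fuel : ∀ f f′ u v → ℓ v ∸ ℓ u < f → ℓ v ∸ ℓ u < f′ → möbF f u v ≡ möbF f′ u v
möbF-fuel (suc f) (suc f′) u v (s≤s l) (s≤s l′) =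
  cong (λ s → if eqWᵇ (word u) (word v) then 1ℚ else if weakLeᵇ u v then ℚ.- s else 0ℚ)
    (∑-cong-∈ (interval u v) (λ {w} w∈ →
      let u≼w , w≼v , w≢v = ∈-interval⁻ {u} {v} {w} w∈
          lt = ℕ.∸-monoˡ-< (≼-strict w≼v w≢v) (≼⇒ℓ≤ u≼w)
      in möbF-fuel f f′ u w (ℕ.<-≤-trans lt l) (ℕ.<-≤-trans lt l′)))

μ-diagonal : ∀ u → μ u u ≡ 1ℚ
μ-diagonal u = cong (λ b → if b then 1ℚ else rest) (eq-true (fromWitness refl))
  where
  eq-true : T (eqWᵇ (word u) (word u)) → eqWᵇ (word u) (word u) ≡ true
  eq-true = Equivalence.to T-≡
  rest : ℚ
  rest = if weakLeᵇ u u then ℚ.- ∑ (interval u u) (möbF (ℓ u ∸ ℓ u) u) else 0ℚ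

μ-recursion : ∀ {u v} → u ≼ v → u ≢ v → μ u v ≡ ℚ.- ∑ (interval u v) (μ u)
μ-recursion {u} {v} l ne = let open ≡-Reasoning in begin
  (if eqWᵇ (word u) (word v) then 1ℚ else if weakLeᵇ u v then ℚ.- s else 0ℚ)
    ≡⟨ cong (λ b → if b then 1ℚ else if weakLeᵇ u v then ℚ.- s else 0ℚ) words-differ ⟩
  (if weakLeᵇ u v then ℚ.- s else 0ℚ)
    ≡⟨ cong (λ b → if b then ℚ.- s else 0ℚ) (Equivalence.to T-≡ (_≼_.isWeakLe l)) ⟩
  ℚ.- s
    ≡⟨ cong ℚ.-_ (∑-cong-∈ (interval u v) (λ {w} w∈ →
      let u≼w , w≼v , w≢v = ∈-interval⁻ {u} {v} {w} w∈
      in möbF-fuel _ _ u w (ℕ.∸-monoˡ-< (≼-strict w≼v w≢v) (≼⇒ℓ≤ u≼w)) (ℕ.n<1+n _))) ⟩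
  ℚ.- ∑ (interval u v) (μ u) ∎
  where
  words-differ : eqWᵇ (word u) (word v) ≡ false
  words-differ = ¬-not (λ e →
    ne (word-injective (toWitness {a? = List.≡-dec ℕ._≟_ (word u) (word v)} (Equivalence.from T-≡ e))))
  s : ℚ
  s = ∑ (interval u v) (möbF (ℓ v ∸ ℓ u) u)

-- This is μ ζ = δ. For u strictly below w it is the recursion for μ, rearranged; for u = w
-- antisymmetry leaves only v = u, and if u is not below w then transitivity leaves nothing.
möbius-sum : ∀ u w → ∑ (allPerms (size u)) (λ v → ζ u v ℚ.* (μ u v ℚ.* ζ v w)) ≡ δ perm-≟ w u
möbius-sum u w with perm-≟ u w | u ≼? w
... | yes refl | _ = let open ≡-Reasoning in begin
  ∑ (allPerms (size u)) (λ v → ζ u v ℚ.* (μ u v ℚ.* ζ v u))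
    ≡⟨ ∑-single _ (allPerms-! (size u)) (∈-allPerms u refl) (λ {v} _ → off v) ⟩
  ζ u u ℚ.* (μ u u ℚ.* ζ u u)
    ≡⟨ cong₂ (λ p q → p ℚ.* (q ℚ.* p)) (ζ-≼ (≼-refl u)) (μ-diagonal u) ⟩
  1ℚ
    ≡⟨ δ-≡ perm-≟ u ⟨
  δ perm-≟ u u ∎
  where
  off : ∀ v → v ≢ u → ζ u v ℚ.* (μ u v ℚ.* ζ v u) ≡ 0ℚ
  off v ne with u ≼? v
  ... | no ¬p = *-vanishˡ _ (ζ-⋠ ¬p)
  ... | yes p = *-vanishʳ (ζ u v) (*-vanishʳ (μ u v) (ζ-⋠ (λ q → ne (≼-antisym q p))))
... | no ne | no ¬p = trans (∑-zero (allPerms (size u)) (λ {v} _ → off v)) (sym (δ-≢ perm-≟ ne))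
  where
  off : ∀ v → ζ u v ℚ.* (μ u v ℚ.* ζ v w) ≡ 0ℚ
  off v with u ≼? v
  ... | no ¬q = *-vanishˡ _ (ζ-⋠ ¬q)
  ... | yes q = *-vanishʳ (ζ u v) (*-vanishʳ (μ u v) (ζ-⋠ (λ r → ¬p (≼-trans q r))))
... | no ne | yes u≼w = let open ≡-Reasoning in begin
  ∑ (allPerms (size u)) (λ v → ζ u v ℚ.* (μ u v ℚ.* ζ v w))
    -- `interval u w` enumerates by the size of its upper end.
    ≡⟨ cong (λ n → ∑ (allPerms n) (λ v → ζ u v ℚ.* (μ u v ℚ.* ζ v w))) size≡ ⟩
  ∑ (allPerms (size w)) (λ v → ζ u v ℚ.* (μ u v ℚ.* ζ v w))
    -- The closed interval from u to w is the half-open one, over which the recursion sums, together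
    -- with the point w.
    ≡⟨ ∑-cong (allPerms (size w)) split ⟩
  ∑ (allPerms (size w)) (λ v → ⟦ intervalᵇ u w v ⟧ ℚ.* μ u v ℚ.+ δ perm-≟ w v ℚ.* μ u w)
    ≡⟨ ∑-+ (allPerms (size w)) _ _ ⟩
  ∑ (allPerms (size w)) (λ v → ⟦ intervalᵇ u w v ⟧ ℚ.* μ u v) ℚ.+
  ∑ (allPerms (size w)) (λ v → δ perm-≟ w v ℚ.* μ u w)
    ≡⟨ cong₂ ℚ._+_ (sym (∑-filter (intervalᵇ u w) (allPerms (size w)) (μ u)))
                   (trans (∑-single _ (allPerms-! (size w)) (∈-allPerms w refl) (λ {v} _ → off v)) on) ⟩
  ∑ (interval u w) (μ u) ℚ.+ μ u w
    ≡⟨ cong (∑ (interval u w) (μ u) ℚ.+_) (μ-recursion {u} {w} u≼w ne) ⟩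
  ∑ (interval u w) (μ u) ℚ.+ ℚ.- ∑ (interval u w) (μ u)
    ≡⟨ ℚ.+-inverseʳ (∑ (interval u w) (μ u)) ⟩
  0ℚ
    ≡⟨ δ-≢ perm-≟ ne ⟨
  δ perm-≟ w u ∎
  where
  size≡ : size u ≡ size w
  size≡ = ≼-size u≼w
  on : δ perm-≟ w w ℚ.* μ u w ≡ μ u w
  on = trans (cong (ℚ._* μ u w) (δ-≡ perm-≟ w)) (ℚ.*-identityˡ (μ u w))
  off : ∀ v → v ≢ w → δ perm-≟ w v ℚ.* μ u w ≡ 0ℚ
  off v v≢w = *-vanishˡ (μ u w) (δ-≢ perm-≟ v≢w)
  split : ∀ v → ζ u v ℚ.* (μ u v ℚ.* ζ v w) ≡ ⟦ intervalᵇ u w v ⟧ ℚ.* μ u v ℚ.+ δ perm-≟ w v ℚ.* μ u w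
  split v with perm-≟ v w
  ... | yes refl = let open ≡-Reasoning in begin
    ζ u v ℚ.* (μ u v ℚ.* ζ v v)
      ≡⟨ cong₂ (λ p q → p ℚ.* (μ u v ℚ.* q)) (ζ-≼ u≼w) (ζ-≼ (≼-refl v)) ⟩
    1ℚ ℚ.* (μ u v ℚ.* 1ℚ)
      ≡⟨ solve 1 (λ x → con 1ℚ :* (x :* con 1ℚ) := con 0ℚ :* x :+ con 1ℚ :* x) refl (μ u v) ⟩
    0ℚ ℚ.* μ u v ℚ.+ 1ℚ ℚ.* μ u v
      ≡⟨ cong (λ q → q ℚ.* μ u v ℚ.+ 1ℚ ℚ.* μ u v) (⟦⟧-false (λ t → proj₂ (proj₂ (intervalᵇ⁻ {u} {v} {v} t)) refl)) ⟨
    ⟦ intervalᵇ u v v ⟧ ℚ.* μ u v ℚ.+ 1ℚ ℚ.* μ u v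
      ≡⟨ cong (λ q → ⟦ intervalᵇ u v v ⟧ ℚ.* μ u v ℚ.+ q ℚ.* μ u v) (δ-≡ perm-≟ v) ⟨
    ⟦ intervalᵇ u v v ⟧ ℚ.* μ u v ℚ.+ δ perm-≟ v v ℚ.* μ u v ∎
  ... | no v≢w = let open ≡-Reasoning in begin
    ζ u v ℚ.* (μ u v ℚ.* ζ v w)
      -- The inserted factor 1 becomes the indicator of v ≠ w, the third factor of `intervalᵇ`.
      ≡⟨ solve 3 (λ p x q → p :* (x :* q) := (p :* (q :* con 1ℚ)) :* x) refl (ζ u v) (μ u v) (ζ v w) ⟩
    (ζ u v ℚ.* (ζ v w ℚ.* 1ℚ)) ℚ.* μ u v
      ≡⟨ cong (λ q → (ζ u v ℚ.* (ζ v w ℚ.* q)) ℚ.* μ u v)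
           (⟦⟧-true {not (eqWᵇ (word v) (word w))} (fromWitnessFalse (v≢w ∘ word-injective))) ⟨
    (ζ u v ℚ.* (ζ v w ℚ.* ⟦ not (eqWᵇ (word v) (word w)) ⟧)) ℚ.* μ u v
      ≡⟨ cong (ℚ._* μ u v) (trans (⟦∧⟧ (weakLeᵇ u v) _) (cong₂ ℚ._*_ (sym (ζ-⟦⟧ u v))
           (trans (⟦∧⟧ (weakLeᵇ v w) _) (cong (ℚ._* ⟦ not (eqWᵇ (word v) (word w)) ⟧) (sym (ζ-⟦⟧ v w)))))) ⟨
    ⟦ intervalᵇ u w v ⟧ ℚ.* μ u v
      ≡⟨ solve 2 (λ x y → x := x :+ con 0ℚ :* y) refl (⟦ intervalᵇ u w v ⟧ ℚ.* μ u v) (μ u w) ⟩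
    ⟦ intervalᵇ u w v ⟧ ℚ.* μ u v ℚ.+ 0ℚ ℚ.* μ u w
      ≡⟨ cong (λ q → ⟦ intervalᵇ u w v ⟧ ℚ.* μ u v ℚ.+ q ℚ.* μ u w) (δ-≢ perm-≟ v≢w) ⟨
    ⟦ intervalᵇ u w v ⟧ ℚ.* μ u v ℚ.+ δ perm-≟ w v ℚ.* μ u w ∎

-- The coordinates of F_u in the monomial basis: F_u is the sum of the M_v with v ≥ u.
G : Perm → FS Perm
G u = map (λ v → (1ℚ , v)) (filter (λ v → T? (weakLeᵇ u v)) (allPerms (size u)))

linℚ-G : ∀ f u → linℚ f (G u) ≡ ∑ (allPerms (size u)) (λ v → ζ u v ℚ.* f v)
linℚ-G f u = trans (linℚ-unweighted f id (filter (λ v → T? (weakLeᵇ u v)) (allPerms (size u))))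
                   (trans (∑-filter (weakLeᵇ u) (allPerms (size u)) f)
    (∑-cong (allPerms (size u)) (λ v → cong (ℚ._* f v) (sym (ζ-⟦⟧ u v)))))

linℚ-M : ∀ f u → linℚ f (M u) ≡ ∑ (allPerms (size u)) (λ v → ζ u v ℚ.* (μ u v ℚ.* f v))
linℚ-M f u = trans (linℚ-weighted f (μ u) id (filter (λ v → T? (weakLeᵇ u v)) (allPerms (size u))))
                   (trans (∑-filter (weakLeᵇ u) (allPerms (size u)) (λ v → μ u v ℚ.* f v))
    (∑-cong (allPerms (size u)) (λ v → cong (ℚ._* (μ u v ℚ.* f v)) (sym (ζ-⟦⟧ u v)))))

-- Expanding every F_v in M_u, the coefficient at w is the sum of μ(u,v) ζ(v,w) over v, evaluated in
-- `möbius-sum`.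
lin-G-M : ∀ u → lin G (M u) ≋ bas u
lin-G-M u .eval f = let open ≡-Reasoning in begin
  linℚ f (lin G (M u))
    ≡⟨ trans (linℚ-lin f G (M u)) (linℚ-M _ u) ⟩
  ∑ P (λ v → ζ u v ℚ.* (μ u v ℚ.* linℚ f (G v)))
    ≡⟨ ∑-cong-∈ P (λ {v} v∈ → trans (cong (λ s → ζ u v ℚ.* (μ u v ℚ.* s))
         (trans (linℚ-G f v) (cong (λ n → ∑ (allPerms n) (λ w → ζ v w ℚ.* f w)) (∈-allPerms⁻ {size u} v∈))))
         (expand v)) ⟩
  ∑ P (λ v → ∑ P (λ w → (ζ u v ℚ.* (μ u v ℚ.* ζ v w)) ℚ.* f w))
    ≡⟨ ∑-swap P P _ ⟩
  ∑ P (λ w → ∑ P (λ v → (ζ u v ℚ.* (μ u v ℚ.* ζ v w)) ℚ.* f w))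
    ≡⟨ ∑-cong P (λ w → trans (∑-*ʳ P (f w) _) (cong (ℚ._* f w) (möbius-sum u w))) ⟩
  ∑ P (λ w → δ perm-≟ w u ℚ.* f w)
    ≡⟨ ∑-single _ (allPerms-! (size u)) (∈-allPerms u refl)
         (λ {w} _ w≢u → *-vanishˡ (f w) (δ-≢ perm-≟ (w≢u ∘ sym))) ⟩
  δ perm-≟ u u ℚ.* f u
    ≡⟨ trans (cong (ℚ._* f u) (δ-≡ perm-≟ u)) (ℚ.*-identityˡ (f u)) ⟩
  f u
    ≡⟨ linℚ-bas f u ⟨
  linℚ f (bas u) ∎
  where
  P : List Perm
  P = allPerms (size u)
  expand : ∀ v → ζ u v ℚ.* (μ u v ℚ.* ∑ P (λ w → ζ v w ℚ.* f w)) ≡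
                 ∑ P (λ w → (ζ u v ℚ.* (μ u v ℚ.* ζ v w)) ℚ.* f w)
  expand v = let open ≡-Reasoning in begin
    ζ u v ℚ.* (μ u v ℚ.* ∑ P (λ w → ζ v w ℚ.* f w))
      ≡⟨ ℚ.*-assoc (ζ u v) (μ u v) _ ⟨
    (ζ u v ℚ.* μ u v) ℚ.* ∑ P (λ w → ζ v w ℚ.* f w)
      ≡⟨ ∑-*ˡ P (ζ u v ℚ.* μ u v) _ ⟨
    ∑ P (λ w → (ζ u v ℚ.* μ u v) ℚ.* (ζ v w ℚ.* f w))
      ≡⟨ ∑-cong P (λ w → solve 4 (λ p x q y → p :* x :* (q :* y) := (p :* (x :* q)) :* y) refl
                         (ζ u v) (μ u v) (ζ v w) (f w)) ⟩
    ∑ P (λ w → (ζ u v ℚ.* (μ u v ℚ.* ζ v w)) ℚ.* f w) ∎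

-- Downward induction on ℓ: if e and f agree strictly above u, then linℚ e (M u) - linℚ f (M u) = e u - f u.
M-separates : ∀ (e f : Perm → ℚ) → (∀ u → linℚ e (M u) ≡ linℚ f (M u)) → ∀ u → e u ≡ f u
M-separates e f eq u = go (suc (size u ℕ.* size u)) u (s≤s (ℕ.m≤m+n _ (ℓ u)))
  where
  c : Perm → Perm → ℚ
  c u v = ζ u v ℚ.* μ u v
  -- `k` is fuel: at 0 the hypothesis contradicts `ℓ-bound`, and any v strictly above u has larger
  -- `ℓ`, which pays for the unit of fuel spent.
  go : ∀ k u → size u ℕ.* size u < k + ℓ u → e u ≡ f u
  go zero    u l = contradiction l (ℕ.≤⇒≯ (ℓ-bound u))
  go (suc k) u l = let open ≡-Reasoning in begin
    e u                             ≡⟨ solve 2 (λ x y → x := (x :+ :- y) :+ y) refl (e u) (f u) ⟩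
    (e u ℚ.+ ℚ.- f u) ℚ.+ f u       ≡⟨ cong (ℚ._+ f u) difference ⟩
    0ℚ ℚ.+ f u                      ≡⟨ ℚ.+-identityˡ (f u) ⟩
    f u                             ∎
    where
    P : List Perm
    P = allPerms (size u)
    d : Perm → ℚ
    d v = e v ℚ.+ ℚ.- f v
    t : (Perm → ℚ) → Perm → ℚ
    t h v = ζ u v ℚ.* (μ u v ℚ.* h v)
    above : ∀ v → v ≢ u → c u v ℚ.* d v ≡ 0ℚ
    above v v≢u with u ≼? v
    ... | no ¬p = *-vanishˡ (d v) (*-vanishˡ (μ u v) (ζ-⋠ ¬p))
    ... | yes p = *-vanishʳ (c u v) (trans (cong (ℚ._+ ℚ.- f v) (go k v (subst (λ n → n ℕ.* n < k + ℓ v) (≼-size p)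
                    (ℕ.<-≤-trans l (subst (_≤ k + ℓ v) (ℕ.+-suc k (ℓ u)) (ℕ.+-monoʳ-≤ k (≼-strict p (v≢u ∘ sym))))))))
                    (ℚ.+-inverseʳ (f v)))
    difference : d u ≡ 0ℚ
    difference = let open ≡-Reasoning in begin
      d u
        ≡⟨ ℚ.*-identityˡ (d u) ⟨
      1ℚ ℚ.* d u
        ≡⟨ cong₂ (λ p q → (p ℚ.* q) ℚ.* d u) (ζ-≼ (≼-refl u)) (μ-diagonal u) ⟨
      c u u ℚ.* d u
        ≡⟨ ∑-single (λ v → c u v ℚ.* d v) (allPerms-! (size u)) (∈-allPerms u refl) (λ {v} _ → above v) ⟨
      ∑ P (λ v → c u v ℚ.* d v)
        ≡⟨ ∑-cong P (λ v → solve 4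
             (λ p x y z → p :* x :* (y :+ :- z) := p :* (x :* y) :+ con (ℚ.- 1ℚ) :* (p :* (x :* z)))
             refl (ζ u v) (μ u v) (e v) (f v)) ⟩
      ∑ P (λ v → t e v ℚ.+ (ℚ.- 1ℚ) ℚ.* t f v)
        ≡⟨ trans (∑-+ P (t e) (λ v → (ℚ.- 1ℚ) ℚ.* t f v)) (cong (∑ P (t e) ℚ.+_) (∑-*ˡ P (ℚ.- 1ℚ) (t f))) ⟩
      ∑ P (t e) ℚ.+ (ℚ.- 1ℚ) ℚ.* ∑ P (t f)
        ≡⟨ cong₂ (λ p q → p ℚ.+ (ℚ.- 1ℚ) ℚ.* q) (trans (sym (linℚ-M e u)) (eq u)) (sym (linℚ-M f u)) ⟩
      linℚ f (M u) ℚ.+ (ℚ.- 1ℚ) ℚ.* linℚ f (M u)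
        ≡⟨ solve 1 (λ x → x :+ con (ℚ.- 1ℚ) :* x := con 0ℚ) refl (linℚ f (M u)) ⟩
      0ℚ ∎

-- The recursion for μ gives only μ ζ = δ. For the other order, f and its composite with `lin M`
-- after `lin G` agree on each M_v by `lin-G-M`, and the M_v separate functionals.
lin-M-G : ∀ u → lin M (G u) ≋ bas u
lin-M-G u .eval f = trans (M-separates (λ v → linℚ f (lin M (G v))) f agree u) (sym (linℚ-bas f u))
  where
  agree : ∀ v → linℚ (λ w → linℚ f (lin M (G w))) (M v) ≡ linℚ f (M v)
  agree v = let open ≡-Reasoning in begin
    linℚ (λ w → linℚ f (lin M (G w))) (M v)   ≡⟨ linℚ-lin f (λ w → lin M (G w)) (M v) ⟨
    linℚ f (lin (λ w → lin M (G w)) (M v))    ≡⟨ lin-lin M G (M v) .eval f ⟨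
    linℚ f (lin M (lin G (M v)))              ≡⟨ lin-congʳ M (lin-G-M v) .eval f ⟩
    linℚ f (lin M (bas v))                    ≡⟨ lin-bas M v .eval f ⟩
    linℚ f (M v)                              ∎

lin-M-lin-G : ∀ x → lin M (lin G x) ≋ x
lin-M-lin-G x = ≋.trans (lin-lin M G x) (≋.trans (lin-congˡ x lin-M-G) (lin-id x))

-- Global descents and factorisations

-- Also holds, vacuously, at p = 0 and at the length of `w`. These boundary cases are used below;
-- the restriction to [n-1] comes from the list of positions that is searched.
GlobalDesc : List ℕ → ℕ → Set
GlobalDesc w p = All (λ a → All (_< a) (drop p w)) (take p w)

globalDesc⁺ : ∀ {w p} → GlobalDesc w p → T (isGlobalDescᵇ w p)
globalDesc⁺ g = All.all⁻ _ (All.map (λ h → All.all⁻ _ (All.map ℕ.<⇒<ᵇ h)) g)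

globalDesc⁻ : ∀ w p → T (isGlobalDescᵇ w p) → GlobalDesc w p
globalDesc⁻ w p t = All.map (λ {a} h → All.map (λ {b} → ℕ.<ᵇ⇒< b a) (All.all⁺ _ (drop p w) h)) (All.all⁺ _ (take p w) t)

take-++ : ∀ (xs ys : List A) j → take (length xs + j) (xs ++ ys) ≡ xs ++ take j ys
take-++ []       ys j = refl
take-++ (x ∷ xs) ys j = cong (x ∷_) (take-++ xs ys j)

drop-++ : ∀ (xs ys : List A) j → drop (length xs + j) (xs ++ ys) ≡ drop j ys
drop-++ []       ys j = refl
drop-++ (x ∷ xs) ys j = drop-++ xs ys j

take-++-≤ : ∀ (xs ys : List A) {j} → j ≤ length xs → take j (xs ++ ys) ≡ take j xs
take-++-≤ []       ys z≤n     = refl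
take-++-≤ (x ∷ xs) ys z≤n     = refl
take-++-≤ (x ∷ xs) ys (s≤s l) = cong (x ∷_) (take-++-≤ xs ys l)

drop-++-≤ : ∀ (xs ys : List A) {j} → j ≤ length xs → drop j (xs ++ ys) ≡ drop j xs ++ ys
drop-++-≤ []       ys z≤n     = refl
drop-++-≤ (x ∷ xs) ys z≤n     = refl
drop-++-≤ (x ∷ xs) ys (s≤s l) = drop-++-≤ xs ys l

module _ (b r : Perm) where

  private
    b′ : List ℕ
    b′ = map (size r +_) (word b)

    ∣b′∣ : length b′ ≡ size b
    ∣b′∣ = List.length-map (size r +_) (word b)

  globalDesc-⊹ˡ⁺ : ∀ {j} → j ≤ size b → GlobalDesc (word b) j → GlobalDesc (word (b ⊹ r)) j
  globalDesc-⊹ˡ⁺ {j} l g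
    rewrite take-++-≤ b′ (word r) (subst (j ≤_) (sym ∣b′∣) l) | drop-++-≤ b′ (word r) (subst (j ≤_) (sym ∣b′∣) l)
    | List.take-map {f = size r +_} j (word b) | List.drop-map {f = size r +_} j (word b) =
    All.map⁺ (All.zipWith (λ (h , k) → All.++⁺ (All.map⁺ (All.map (ℕ.+-monoʳ-< (size r)) h)) k)
      (g , All.map⁻ (subst (All _) (List.take-map j (word b)) (All.take⁺ j (⊹-globalDesc b r)))))

  globalDesc-⊹ˡ⁻ : ∀ {j} → j ≤ size b → GlobalDesc (word (b ⊹ r)) j → GlobalDesc (word b) j
  globalDesc-⊹ˡ⁻ {j} l g
    rewrite take-++-≤ b′ (word r) (subst (j ≤_) (sym ∣b′∣) l) | drop-++-≤ b′ (word r) (subst (j ≤_) (sym ∣b′∣) l)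
    | List.take-map {f = size r +_} j (word b) | List.drop-map {f = size r +_} j (word b) =
    All.map (λ h → All.map (ℕ.+-cancelˡ-< (size r) _ _) (All.map⁻ (All.++⁻ˡ _ h))) (All.map⁻ g)

  globalDesc-⊹ʳ⁺ : ∀ {j} → GlobalDesc (word r) j → GlobalDesc (word (b ⊹ r)) (size b + j)
  globalDesc-⊹ʳ⁺ {j} g
    rewrite sym ∣b′∣ | take-++ b′ (word r) j | drop-++ b′ (word r) j =
    All.++⁺ (All.map (All.drop⁺ j) (⊹-globalDesc b r)) g

  globalDesc-⊹ʳ⁻ : ∀ {j} → GlobalDesc (word (b ⊹ r)) (size b + j) → GlobalDesc (word r) j
  globalDesc-⊹ʳ⁻ {j} g
    rewrite sym ∣b′∣ | take-++ b′ (word r) j | drop-++ b′ (word r) j = All.++⁻ʳ b′ g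

  -- The boundary is position 0 of `r`, where the condition is vacuous.
  globalDesc-⊹ : GlobalDesc (word (b ⊹ r)) (size b)
  globalDesc-⊹ = subst (GlobalDesc (word (b ⊹ r))) (ℕ.+-identityʳ (size b)) (globalDesc-⊹ʳ⁺ [])

count : (ℕ → Bool) → List ℕ → ℕ
count f xs = length (filter (λ p → T? (f p)) xs)

count-++ : ∀ f xs ys → count f (xs ++ ys) ≡ count f xs + count f ys
count-++ f xs ys = trans (cong length (List.filter-++ _ xs ys)) (List.length-++ (filter _ xs))

count-none : ∀ {f xs} → (∀ {p} → p ∈ xs → ¬ T (f p)) → count f xs ≡ 0
count-none h = cong length (List.filter-none _ (All.tabulate h))

count≡0 : ∀ {f xs} → count f xs ≡ 0 → ∀ {p} → p ∈ xs → ¬ T (f p)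
count≡0 {f} {xs} e p∈ t with q ← ∈-filter⁺ (λ p → T? (f p)) p∈ t with filter (λ p → T? (f p)) xs
count≡0 () p∈ t | _ ∷ _
count≡0 e  p∈ t | [] with () ← q

count-map : ∀ {f h} (g : ℕ → ℕ) xs → (∀ p → T (f (g p)) → T (h p)) → (∀ p → T (h p) → T (f (g p))) →
  count f (map g xs) ≡ count h xs
count-map g [] i j = refl
count-map {f} {h} g (x ∷ xs) i j with f (g x) | h x | i x | j x
... | true  | true  | _ | _ = cong suc (count-map g xs i j)
... | false | false | _ | _ = count-map g xs i j
... | true  | false | k | _ = contradiction _ k
... | false | true  | _ | k = contradiction _ k

-- For factors of sizes m + 1 and k + 1 this sorts the cut positions of the product into those
-- inside the first factor, the boundary, and those inside the second.
range1-+ : ∀ m k → range1 (m + suc k) ≡ range1 m ++ suc m ∷ map (suc m +_) (range1 k)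
range1-+ m k = begin
  range1 (m + suc k)
    ≡⟨ trans (range1≡ (m + suc k)) (applyUpTo-+ suc m (suc k)) ⟩
  applyUpTo suc m ++ applyUpTo (λ i → suc (m + i)) (suc k)
    ≡⟨ cong₂ _++_ (sym (range1≡ m)) (cong₂ _∷_ (cong suc (ℕ.+-identityʳ m)) tail) ⟩
  range1 m ++ suc m ∷ map (suc m +_) (range1 k) ∎
  where
  open ≡-Reasoning
  applyUpTo-+ : ∀ (f : ℕ → ℕ) m n → applyUpTo f (m + n) ≡ applyUpTo f m ++ applyUpTo (λ i → f (m + i)) n
  applyUpTo-+ f zero    n = refl
  applyUpTo-+ f (suc m) n = cong (f 0 ∷_) (applyUpTo-+ (f ∘ suc) m n)
  tail : applyUpTo (λ i → suc (m + suc i)) k ≡ map (suc m +_) (range1 k)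
  tail = sym (trans (cong (map (suc m +_)) (range1≡ k)) (List.map-applyUpTo suc (suc m +_) k))

-- The future letters: this set is the basis of V in Q(V).
Connected : Set
Connected = Σ Perm (λ u → T (inSᵏ 1 u))

connected-≟ : DecidableEquality Connected
connected-≟ (u , p) (v , q) with perm-≟ u v
... | no ne    = no (ne ∘ cong proj₁)
... | yes refl = yes (cong (u ,_) (T-irrelevant p q))

inSᵏ⁺ : ∀ {k u} → 1 ≤ size u → numGlobalDesc u ≡ k → T (inSᵏ (suc k) u)
inSᵏ⁺ {k} {u} l e = Equivalence.from T-∧ (nonzero l , ℕ.≡⇒≡ᵇ (numGlobalDesc u) k e)
  where
  nonzero : ∀ {n} → 1 ≤ n → T (not (n ℕ.≡ᵇ 0))
  nonzero (s≤s _) = _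

inSᵏ⁻ : ∀ {k u} → T (inSᵏ (suc k) u) → 1 ≤ size u × numGlobalDesc u ≡ k
inSᵏ⁻ {k} {u} t with z , e ← Equivalence.to (T-∧ {not (size u ℕ.≡ᵇ 0)}) t =
  nonzero (size u) z , ℕ.≡ᵇ⇒≡ (numGlobalDesc u) k e
  where
  nonzero : ∀ n → T (not (n ℕ.≡ᵇ 0)) → 1 ≤ n
  nonzero (suc n) _ = s≤s z≤n

inSᵏ-unique : ∀ {i j u} → T (inSᵏ i u) → T (inSᵏ j u) → i ≡ j
inSᵏ-unique {zero}  {zero}  s t = refl
inSᵏ-unique {suc i} {suc j} {u} s t =
  cong suc (trans (sym (proj₂ (inSᵏ⁻ {i} {u} s))) (proj₂ (inSᵏ⁻ {j} {u} t)))
inSᵏ-unique {zero}  {suc j} {u} s t =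
  contradiction (subst (1 ≤_) (ℕ.≡ᵇ⇒≡ (size u) 0 s) (proj₁ (inSᵏ⁻ {j} {u} t))) (λ ())
inSᵏ-unique {suc i} {zero}  {u} s t =
  contradiction (subst (1 ≤_) (ℕ.≡ᵇ⇒≡ (size u) 0 t) (proj₁ (inSᵏ⁻ {i} {u} s))) (λ ())

size-connected : (b : Connected) → 1 ≤ size (proj₁ b)
size-connected (b , c) = proj₁ (inSᵏ⁻ {0} {b} c)

connected⁻ : ∀ (b : Connected) {j} → 1 ≤ j → j < size (proj₁ b) → ¬ GlobalDesc (word (proj₁ b)) j
connected⁻ (b , c) {j} 1≤j j<b g =
  count≡0 {isGlobalDescᵇ (word b)} (proj₂ (inSᵏ⁻ {0} {b} c)) (∈-range1⁺ 1≤j (ℕ.∸-monoˡ-≤ 1 j<b)) (globalDesc⁺ g)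

connected⁺ : ∀ b → 1 ≤ size b → (∀ {j} → 1 ≤ j → j < size b → ¬ GlobalDesc (word b) j) → T (inSᵏ 1 b)
connected⁺ b l h = inSᵏ⁺ {0} {b} l (count-none {isGlobalDescᵇ (word b)} {range1 (size b ∸ 1)} (λ {p} p∈ t →
  let 1≤p , p≤ = ∈-range1⁻ p∈ in
  h 1≤p (ℕ.≤-<-trans p≤ (ℕ.∸-monoʳ-< {size b} {1} {0} (s≤s z≤n) l)) (globalDesc⁻ (word b) p t)))

-- Nothing is counted inside `b`, one global descent sits at the boundary, and the rest are those of
-- `r`. With `r` empty the boundary would be the end of the word, which is not counted.
numGlobalDesc-⊹ : ∀ (b : Connected) r → 1 ≤ size r → numGlobalDesc (proj₁ b ⊹ r) ≡ suc (numGlobalDesc r)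
numGlobalDesc-⊹ b@(u , _) r l = begin
  count f (range1 (size (u ⊹ r) ∸ 1))
    ≡⟨ cong (λ n → count f (range1 n)) len ⟩
  count f (range1 (m + suc k))
    ≡⟨ trans (cong (count f) (range1-+ m k)) (count-++ f (range1 m) _) ⟩
  count f (range1 m) + count f (suc m ∷ map (suc m +_) (range1 k))
    ≡⟨ cong₂ _+_ (count-none {f} {range1 m} before) (cong length
         (List.filter-accept (λ p → T? (f p)) {x = suc m} {xs = map (suc m +_) (range1 k)} at-boundary)) ⟩
  suc (count f (map (suc m +_) (range1 k)))
    ≡⟨ cong suc (count-map (suc m +_) (range1 k) after⁻ after⁺) ⟩
  suc (numGlobalDesc r) ∎
  where
  open ≡-Reasoning
  f : ℕ → Bool
  f = isGlobalDescᵇ (word (u ⊹ r))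
  m k : ℕ
  m = size u ∸ 1
  k = size r ∸ 1
  1+m : suc m ≡ size u
  1+m = ℕ.m+[n∸m]≡n (size-connected b)
  1+k : suc k ≡ size r
  1+k = ℕ.m+[n∸m]≡n l
  len : size (u ⊹ r) ∸ 1 ≡ m + suc k
  len = cong (_∸ 1) (trans (size-⊹ u r) (sym (cong₂ _+_ 1+m 1+k)))
  before : ∀ {p} → p ∈ range1 m → ¬ T (f p)
  before {p} p∈ t = let 1≤p , p≤m = ∈-range1⁻ p∈
                        p<u = subst (suc p ≤_) 1+m (s≤s p≤m) in
    connected⁻ b 1≤p p<u (globalDesc-⊹ˡ⁻ u r (ℕ.<⇒≤ p<u) (globalDesc⁻ (word (u ⊹ r)) p t))
  at-boundary : T (f (suc m))
  at-boundary = subst (T ∘ f) (sym 1+m) (globalDesc⁺ (globalDesc-⊹ u r))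
  after⁻ : ∀ p → T (f (suc m + p)) → T (isGlobalDescᵇ (word r) p)
  after⁻ p t = globalDesc⁺ (globalDesc-⊹ʳ⁻ u r
    (globalDesc⁻ (word (u ⊹ r)) (size u + p) (subst (λ n → T (f (n + p))) 1+m t)))
  after⁺ : ∀ p → T (isGlobalDescᵇ (word r) p) → T (f (suc m + p))
  after⁺ p t = subst (λ n → T (f (n + p))) (sym 1+m) (globalDesc⁺ (globalDesc-⊹ʳ⁺ u r (globalDesc⁻ (word r) p t)))

-- Unique factorisation into connected permutations

comp : List Connected → Perm
comp []      = perm [] _
comp (b ∷ w) = proj₁ b ⊹ comp w

⊹-identityˡ : ∀ u → perm [] _ ⊹ u ≡ u
⊹-identityˡ u = word-injective refl

comp-++ : ∀ x y → comp (x ++ y) ≡ comp x ⊹ comp y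
comp-++ []      y = sym (⊹-identityˡ (comp y))
comp-++ (b ∷ x) y = trans (cong (proj₁ b ⊹_) (comp-++ x y)) (sym (⊹-assoc (proj₁ b) (comp x) (comp y)))

size-comp : ∀ b w → 1 ≤ size (comp (b ∷ w))
size-comp b w = subst (1 ≤_) (sym (size-⊹ (proj₁ b) (comp w))) (ℕ.≤-trans (size-connected b) (ℕ.m≤m+n _ _))

inSᵏ-comp : ∀ w → T (inSᵏ (length w) (comp w))
inSᵏ-comp []          = _
inSᵏ-comp (b ∷ [])    = subst (T ∘ inSᵏ 1) (sym (⊹-identityʳ (proj₁ b))) (proj₂ b)
inSᵏ-comp (b ∷ c ∷ w) = inSᵏ⁺ {_} {comp (b ∷ c ∷ w)} (size-comp b (c ∷ w)) (trans
  (numGlobalDesc-⊹ b (comp (c ∷ w)) (size-comp c w))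
  (cong suc (proj₂ (inSᵏ⁻ {length w} {comp (c ∷ w)} (inSᵏ-comp (c ∷ w))))))

-- If `b` were shorter, the boundary after it would be a global descent of the common product lying
-- inside `b′`, which has none.
⊹-connected-size : ∀ b b′ {r r′} → proj₁ b ⊹ r ≡ proj₁ b′ ⊹ r′ → ¬ size (proj₁ b) < size (proj₁ b′)
⊹-connected-size b b′ {r} {r′} e l = connected⁻ b′ (size-connected b) l (globalDesc-⊹ˡ⁻ (proj₁ b′) r′ (ℕ.<⇒≤ l)
  (subst (λ u → GlobalDesc (word u) (size (proj₁ b))) e (globalDesc-⊹ (proj₁ b) r)))

⊹-connected-injective : ∀ b b′ {r r′} → proj₁ b ⊹ r ≡ proj₁ b′ ⊹ r′ → b ≡ b′ × r ≡ r′
⊹-connected-injective b@(u , _) b′@(u′ , _) {r} {r′} e with ℕ.<-cmp (size u) (size u′)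
... | tri< l _ _ = contradiction l (⊹-connected-size b b′ {r} {r′} e)
... | tri> _ _ l = contradiction l (⊹-connected-size b′ b {r′} {r} (sym e))
... | tri≈ _ s _
  with eu , er ← ++-cancel {x = map (size r +_) (word u)} {map (size r′ +_) (word u′)}
         (trans (List.length-map _ (word u)) (trans s (sym (List.length-map _ (word u′))))) (cong word e)
  with refl ← word-injective {r} {r′} er
  with refl ← word-injective {u} {u′} (List.map-injective (ℕ.+-cancelˡ-≡ (size r) _ _) eu) =
  cong (u ,_) (T-irrelevant _ _) , refl

comp-injective : ∀ w w′ → comp w ≡ comp w′ → w ≡ w′
comp-injective []      []        e = refl
comp-injective []      (b ∷ w)   e with () ← subst (λ u → 1 ≤ size u) (sym e) (size-comp b w)
comp-injective (b ∷ w) []        e with () ← subst (λ u → 1 ≤ size u) e (size-comp b w)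
comp-injective (b ∷ w) (b′ ∷ w′) e with refl , e′ ← ⊹-connected-injective b b′ {comp w} {comp w′} e =
  cong (b ∷_) (comp-injective w w′ e′)

least : ∀ (P : ℕ → Bool) n → T (P n) → ∃ λ m → m ≤ n × T (P m) × (∀ {j} → j < m → ¬ T (P j))
least P n pn with T? (P 0)
least P n       pn | yes p0 = 0 , z≤n , p0 , λ ()
least P zero    pn | no ¬p0 = contradiction pn ¬p0
least P (suc n) pn | no ¬p0 with m , m≤n , pm , min ← least (P ∘ suc) n pn =
  suc m , s≤s m≤n , pm , λ { {zero} _ → ¬p0 ; {suc j} (s≤s l) → min l }

cnt-++ : ∀ a x y → cnt a (x ++ y) ≡ cnt a x + cnt a y
cnt-++ a x y = trans (cong length (List.filter-++ (_<? a) x y)) (List.length-++ (filter (_<? a) x))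

-- A permutation is its own standardisation. At a global descent a letter on the left has all
-- letters on the right below it, so its rank grows by their number; a letter on the right has none
-- of those on the left below it.
⊹-globalDesc⁻¹ : ∀ u p → GlobalDesc (word u) p → u ≡ st (take p (word u)) ⊹ st (drop p (word u))
⊹-globalDesc⁻¹ u p g = word-injective (begin
  word u                                 ≡⟨ List.take++drop≡id p (word u) ⟨
  x ++ y                                 ≡⟨ stW-id (subst IsPermWord (sym (List.take++drop≡id p (word u))) (word-↭ u)) ⟨
  stW (x ++ y)                           ≡⟨ List.map-++ (λ a → suc (cnt a (x ++ y))) x y ⟩
  map (λ a → suc (cnt a (x ++ y))) x ++ map (λ a → suc (cnt a (x ++ y))) y
    ≡⟨ cong₂ _++_ (map-cong-∈ left) (map-cong-∈ right) ⟩
  map (λ a → size (st y) + suc (cnt a x)) x ++ stW y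
    ≡⟨ cong₂ _++_ (trans (List.map-∘ x) (cong (map (size (st y) +_)) (sym (st-word (take-! u p)))))
                  (sym (st-word (drop-! u p))) ⟩
  word (st x ⊹ st y) ∎)
  where
  open ≡-Reasoning
  x y : List ℕ
  x = take p (word u)
  y = drop p (word u)
  left : ∀ {a} → a ∈ x → suc (cnt a (x ++ y)) ≡ size (st y) + suc (cnt a x)
  left {a} a∈ = begin
    suc (cnt a (x ++ y))           ≡⟨ cong suc (cnt-++ a x y) ⟩
    suc (cnt a x + cnt a y)        ≡⟨ cong (λ w → suc (cnt a x + length w)) (List.filter-all (_<? a) (All.lookup g a∈)) ⟩
    suc (cnt a x) + length y       ≡⟨ ℕ.+-comm (suc (cnt a x)) (length y) ⟩
    length y + suc (cnt a x)       ≡⟨ cong (_+ suc (cnt a x)) (st-size (drop-! u p)) ⟨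
    size (st y) + suc (cnt a x)    ∎
  right : ∀ {a} → a ∈ y → suc (cnt a (x ++ y)) ≡ suc (cnt a y)
  right {a} a∈ = cong suc (trans (cnt-++ a x y) (cong (_+ cnt a y) (cong length
    (List.filter-none (_<? a) (All.map (λ h → ℕ.<-asym (All.lookup h a∈)) g)))))

-- Nothing follows the last letter. This vacuous case guarantees that the search for a positive cut
-- position succeeds.
globalDesc-size : ∀ u → GlobalDesc (word u) (size u)
globalDesc-size u = subst (λ y → All (λ a → All (_< a) y) (take (size u) (word u)))
  (sym (List.drop-all (size u) (word u) ℕ.≤-refl)) (All.universal (λ _ → []) _)

-- Cut at the first admissible position: an earlier global descent inside the left part would be one
-- of u as well.
split-connected : ∀ u → 1 ≤ size u → ∃ λ (b : Connected) → ∃ λ r → u ≡ proj₁ b ⊹ r × size r < size u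
split-connected u l
  -- The search runs over `suc j` in order to skip position 0; the bound `size u ∸ 1` stands for the
  -- end of the word.
  with m , m≤ , gm , min ← least (λ j → isGlobalDescᵇ (word u) (suc j)) (size u ∸ 1)
    (subst (T ∘ isGlobalDescᵇ (word u)) (sym (ℕ.m+[n∸m]≡n l)) (globalDesc⁺ (globalDesc-size u))) =
  (b , connected⁺ b (subst (1 ≤_) (sym ∣b∣) (s≤s z≤n)) conn) , r , eq ,
  subst (size r <_) (trans (sym (size-⊹ b r)) (cong size (sym eq)))
    (ℕ.m<n+m (size r) (subst (0 <_) (sym ∣b∣) (s≤s z≤n)))
  where
  b r : Perm
  b = st (take (suc m) (word u))
  r = st (drop (suc m) (word u))
  eq : u ≡ b ⊹ r
  eq = ⊹-globalDesc⁻¹ u (suc m) (globalDesc⁻ (word u) (suc m) gm)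
  ∣b∣ : size b ≡ suc m
  ∣b∣ = trans (st-size (take-! u (suc m))) (trans (List.length-take (suc m) (word u))
    (ℕ.m≤n⇒m⊓n≡m (subst (suc m ≤_) (ℕ.m+[n∸m]≡n l) (s≤s m≤))))
  conn : ∀ {j} → 1 ≤ j → j < size b → ¬ GlobalDesc (word b) j
  conn {suc j} _ j<b g = min (ℕ.≤-pred (subst (suc j <_) ∣b∣ j<b))
    (globalDesc⁺ (subst (λ v → GlobalDesc (word v) (suc j)) (sym eq) (globalDesc-⊹ˡ⁺ b r (ℕ.<⇒≤ j<b) g)))

abstract
  factorisation : ∀ n u → size u ≤ n → ∃ λ w → comp w ≡ u
  factorisation n u l = [ (λ e → [] , sym (size-0 u e)) , step n l ∘ split-connected u ]′ (zero-or-positive (size u))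
    where
    zero-or-positive : ∀ k → k ≡ 0 ⊎ 1 ≤ k
    zero-or-positive zero    = inj₁ refl
    zero-or-positive (suc k) = inj₂ (s≤s z≤n)
    step : ∀ n → size u ≤ n → (∃ λ (b : Connected) → ∃ λ r → u ≡ proj₁ b ⊹ r × size r < size u) → ∃ λ w → comp w ≡ u
    step zero    l (_ , _ , _ , r<) = contradiction (ℕ.<-≤-trans r< l) (λ ())
    step (suc n) l (b , r , eq , r<) =
      let w , e = factorisation n r (ℕ.≤-pred (ℕ.≤-trans r< l)) in b ∷ w , trans (cong (proj₁ b ⊹_) e) (sym eq)

  dec : Perm → List Connected
  dec u = proj₁ (factorisation (size u) u ℕ.≤-refl)

  comp-dec : ∀ u → comp (dec u) ≡ u
  comp-dec u = proj₂ (factorisation (size u) u ℕ.≤-refl)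

dec-comp : ∀ w → dec (comp w) ≡ w
dec-comp w = comp-injective (dec (comp w)) w (comp-dec (comp w))

inSᵏ-dec : ∀ u → T (inSᵏ (length (dec u)) u)
inSᵏ-dec u = subst (T ∘ inSᵏ (length (dec u))) (comp-dec u) (inSᵏ-comp (dec u))

length-dec : ∀ {k u} → T (inSᵏ k u) → length (dec u) ≡ k
length-dec {k} {u} = inSᵏ-unique {length (dec u)} {k} {u} (inSᵏ-dec u)

-- The coproduct in the monomial basis

δ-× : ∀ (d : DecidableEquality A) (e : DecidableEquality B) a b x y →
  δ (×-dec d e) (a , b) (x , y) ≡ δ d a x ℚ.* δ e b y
δ-× d e a b x y = cases (d x a) (e y b)
  where
  cases : Dec (x ≡ a) → Dec (y ≡ b) → δ (×-dec d e) (a , b) (x , y) ≡ δ d a x ℚ.* δ e b y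
  cases (yes refl) (yes refl) = trans (δ-≡ (×-dec d e) (a , b)) (sym (cong₂ ℚ._*_ (δ-≡ d a) (δ-≡ e b)))
  cases (no ne) _ = trans (δ-≢ (×-dec d e) (ne ∘ ,-injectiveˡ)) (sym (*-vanishˡ (δ e b y) (δ-≢ d ne)))
  cases _ (no ne) = trans (δ-≢ (×-dec d e) (ne ∘ ,-injectiveʳ)) (sym (*-vanishʳ (δ d a x) (δ-≢ e ne)))

_⊗₁_ : (A → FS A′) → (B → FS B′) → A × B → FS (A′ × B′)
(g ⊗₁ h) p = g (proj₁ p) ⊗ h (proj₂ p)

-- Deconcatenation of factorisations. As in the values of `G`, the basis vector at v stands here for
-- M_v.
D : Perm → FS (Perm × Perm)
D u = map (λ i → (1ℚ , (comp (take i (dec u)) , comp (drop i (dec u))))) (upTo (suc (length (dec u))))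

coeff-G : ∀ a u → linℚ (δ perm-≟ a) (G u) ≡ ζ u a
coeff-G a u = trans (linℚ-G (δ perm-≟ a) u) (cases (size a ℕ.≟ size u))
  where
  cases : Dec (size a ≡ size u) → ∑ (allPerms (size u)) (λ v → ζ u v ℚ.* δ perm-≟ a v) ≡ ζ u a
  cases (yes e) = trans
    (∑-single _ (allPerms-! (size u)) (∈-allPerms a e) (λ {v} _ v≢a → *-vanishʳ (ζ u v) (δ-≢ perm-≟ v≢a)))
    (trans (cong (ζ u a ℚ.*_) (δ-≡ perm-≟ a)) (ℚ.*-identityʳ (ζ u a)))
  cases (no ne) = trans
    (∑-zero (allPerms (size u)) (λ {v} v∈ → *-vanishʳ (ζ u v)
      (δ-≢ perm-≟ (λ { refl → ne (∈-allPerms⁻ {size u} v∈) }))))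
    (sym (ζ-⋠ (λ l → ne (sym (≼-size l)))))

-- Unique factorisation allows only the cut after as many factors as `a` has, and if v = a ⊹ b the
-- word of v is `dec a ++ dec b`.
coeff-D : ∀ a b v → linℚ (δ (×-dec perm-≟ perm-≟) (a , b)) (D v) ≡ δ perm-≟ v (a ⊹ b)
coeff-D a b v = trans
  (linℚ-unweighted (δ (×-dec perm-≟ perm-≟) (a , b)) (λ i → (comp (take i w) , comp (drop i w))) (upTo (suc (length w))))
  (cases (perm-≟ (a ⊹ b) v))
  where
  w : List Connected
  w = dec v
  term : ℕ → ℚ
  term i = δ (×-dec perm-≟ perm-≟) (a , b) (comp (take i w) , comp (drop i w))
  prefix-length : ∀ {i} → i ∈ upTo (suc (length w)) → comp (take i w) ≡ a → i ≡ length (dec a)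
  prefix-length {i} i∈ e = begin
    i                             ≡⟨ ℕ.m≤n⇒m⊓n≡m (ℕ.≤-pred (∈-upTo⁻ i∈)) ⟨
    i ℕ.⊓ length w                ≡⟨ List.length-take i w ⟨
    length (take i w)             ≡⟨ cong length (dec-comp (take i w)) ⟨
    length (dec (comp (take i w))) ≡⟨ cong (length ∘ dec) e ⟩
    length (dec a)                ∎
    where open ≡-Reasoning
  cases : Dec (a ⊹ b ≡ v) → ∑ (upTo (suc (length w))) term ≡ δ perm-≟ v (a ⊹ b)
  cases (no ne) = trans
    (∑-zero (upTo (suc (length w))) (λ {i} _ → δ-≢ (×-dec perm-≟ perm-≟) (λ e → ne (begin
      a ⊹ b                                  ≡⟨ cong₂ _⊹_ (,-injectiveˡ e) (,-injectiveʳ e) ⟨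
      comp (take i w) ⊹ comp (drop i w)      ≡⟨ comp-++ (take i w) (drop i w) ⟨
      comp (take i w ++ drop i w)            ≡⟨ cong comp (List.take++drop≡id i w) ⟩
      comp w                                 ≡⟨ comp-dec v ⟩
      v                                      ∎))))
    (sym (δ-≢ perm-≟ ne))
    where open ≡-Reasoning
  cases (yes e) = trans
    (∑-single term (Unique.upTo⁺ (suc (length w))) (∈-upTo⁺ (s≤s i≤)) (λ {i} i∈ ne →
      δ-≢ (×-dec perm-≟ perm-≟) (λ e′ → ne (prefix-length i∈ (,-injectiveˡ e′)))))
    (trans (trans (cong (δ (×-dec perm-≟ perm-≟) (a , b)) (cong₂ _,_ take≡ drop≡)) (δ-≡ (×-dec perm-≟ perm-≟) (a , b)))
           (sym (trans (cong (δ perm-≟ v) e) (δ-≡ perm-≟ v))))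
    where
    w≡ : w ≡ dec a ++ dec b
    w≡ = comp-injective w (dec a ++ dec b) (trans (comp-dec v) (trans (sym e)
      (sym (trans (comp-++ (dec a) (dec b)) (cong₂ _⊹_ (comp-dec a) (comp-dec b))))))
    i≤ : length (dec a) ≤ length w
    i≤ = subst (length (dec a) ≤_) (sym (trans (cong length w≡) (List.length-++ (dec a)))) (ℕ.m≤m+n _ _)
    take≡ : comp (take (length (dec a)) w) ≡ a
    take≡ = trans (cong (comp ∘ take (length (dec a))) w≡)
      (trans (cong comp (trans (take-++-≤ (dec a) (dec b) ℕ.≤-refl) (List.take-all (length (dec a)) (dec a) ℕ.≤-refl)))
             (comp-dec a))
    drop≡ : comp (drop (length (dec a)) w) ≡ b
    drop≡ = trans (cong (comp ∘ drop (length (dec a))) w≡)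
      (trans (cong comp (trans (drop-++-≤ (dec a) (dec b) ℕ.≤-refl)
                               (cong (_++ dec b) (List.drop-all (length (dec a)) (dec a) ℕ.≤-refl))))
             (comp-dec b))

-- The left side is the coefficient of M_a ⊗ M_b in Δ F_u. Comparable permutations have equal size,
-- so only the cut at `size a` can contribute.
coeff-ΔF : ∀ a b u →
  ∑ (upTo (suc (size u))) (λ p → ζ (st (take p (word u))) a ℚ.* ζ (st (drop p (word u))) b)
    ≡ ζ u (a ⊹ b)
coeff-ΔF a b u = cases (u ≼? (a ⊹ b))
  where
  x y : ℕ → Perm
  x p = st (take p (word u))
  y p = st (drop p (word u))
  term : ℕ → ℚ
  term p = ζ (x p) a ℚ.* ζ (y p) b
  position : ∀ {p} → p ∈ upTo (suc (size u)) → x p ≼ a → p ≡ size a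
  position {p} p∈ l = begin
    p                        ≡⟨ ℕ.m≤n⇒m⊓n≡m (ℕ.≤-pred (∈-upTo⁻ p∈)) ⟨
    p ℕ.⊓ size u             ≡⟨ List.length-take p (word u) ⟨
    length (take p (word u)) ≡⟨ st-size (take-! u p) ⟨
    size (x p)               ≡⟨ ≼-size l ⟩
    size a                   ∎
    where open ≡-Reasoning
  combine : ∀ {p} → p ≡ size a → x p ≼ a → y p ≼ b → u ≼ a ⊹ b
  combine refl = ≼-⊹⁺
  off : ∀ {p} → ¬ u ≼ a ⊹ b → p ∈ upTo (suc (size u)) → Dec (x p ≼ a) → Dec (y p ≼ b) → term p ≡ 0ℚ
  off {p} ¬l p∈ (no ¬s) _       = *-vanishˡ (ζ (y p) b) (ζ-⋠ ¬s)
  off {p} ¬l p∈ _       (no ¬t) = *-vanishʳ (ζ (x p) a) (ζ-⋠ ¬t)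
  off {p} ¬l p∈ (yes s) (yes t) = contradiction (combine (position p∈ s) s t) ¬l
  on : u ≼ a ⊹ b → size u ≡ size a + size b × x (size a) ≼ a × y (size a) ≼ b →
    ∑ (upTo (suc (size u))) term ≡ ζ u (a ⊹ b)
  on l (s , xa , yb) = trans
    (∑-single term (Unique.upTo⁺ (suc (size u)))
      (∈-upTo⁺ (s≤s (subst (size a ≤_) (sym s) (ℕ.m≤m+n (size a) (size b)))))
      (λ {p} p∈ ne → *-vanishˡ (ζ (y p) b) (ζ-⋠ (λ t → ne (position p∈ t)))))
    (trans (cong₂ ℚ._*_ (ζ-≼ xa) (ζ-≼ yb)) (sym (ζ-≼ l)))
  cases : Dec (u ≼ a ⊹ b) → ∑ (upTo (suc (size u))) term ≡ ζ u (a ⊹ b)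
  cases (yes l) = on l (≼-⊹⁻ l)
  cases (no ¬l) = trans (∑-zero (upTo (suc (size u))) (λ {p} p∈ → off ¬l p∈ (x p ≼? a) (y p ≼? b))) (sym (ζ-⋠ ¬l))

-- In monomial coordinates the coproduct is deconcatenation of the factorisation into connected permutations.
G-ΔF : ∀ u → lin (G ⊗₁ G) (ΔF u) ≋ lin D (G u)
G-ΔF u = Eqv⇒≋ (×-dec perm-≟ perm-≟) (lin (G ⊗₁ G) (ΔF u)) (lin D (G u)) λ (a , b) → begin
  coeff (×-dec perm-≟ perm-≟) (lin (G ⊗₁ G) (ΔF u)) (a , b)
    ≡⟨ trans (coeff-linℚ (×-dec perm-≟ perm-≟) (lin (G ⊗₁ G) (ΔF u)) (a , b)) (linℚ-lin _ (G ⊗₁ G) (ΔF u)) ⟩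
  linℚ (λ p → linℚ (δ (×-dec perm-≟ perm-≟) (a , b)) ((G ⊗₁ G) p)) (ΔF u)
    ≡⟨ linℚ-cong (ΔF u) (λ (x , y) → trans (linℚ-cong (G x ⊗ G y) (λ (v , w) → δ-× perm-≟ perm-≟ a b v w))
         (trans (linℚ-⊗-* (δ perm-≟ a) (δ perm-≟ b) (G x) (G y)) (cong₂ ℚ._*_ (coeff-G a x) (coeff-G b y)))) ⟩
  linℚ (λ (x , y) → ζ x a ℚ.* ζ y b) (ΔF u)
    ≡⟨ trans (linℚ-unweighted (λ (x , y) → ζ x a ℚ.* ζ y b)
                (λ p → (st (take p (word u)) , st (drop p (word u)))) (upTo (suc (size u))))
             (coeff-ΔF a b u) ⟩
  ζ u (a ⊹ b)
    ≡⟨ coeff-G (a ⊹ b) u ⟨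
  linℚ (δ perm-≟ (a ⊹ b)) (G u)
    ≡⟨ linℚ-cong (G u) (λ v → trans (coeff-D a b v) (δ-sym v (a ⊹ b))) ⟨
  linℚ (λ v → linℚ (δ (×-dec perm-≟ perm-≟) (a , b)) (D v)) (G u)
    ≡⟨ trans (coeff-linℚ (×-dec perm-≟ perm-≟) (lin D (G u)) (a , b)) (linℚ-lin _ D (G u)) ⟨
  coeff (×-dec perm-≟ perm-≟) (lin D (G u)) (a , b) ∎
  where
  open ≡-Reasoning
  δ-sym : ∀ v w → δ perm-≟ v w ≡ δ perm-≟ w v
  δ-sym v w with perm-≟ v w
  ... | yes refl = refl
  ... | no ne    = trans (δ-≢ perm-≟ (ne ∘ sym)) (sym (δ-≢ perm-≟ ne))

lin-⊗₁ : ∀ {A″ B″ : Set} (g : A′ → FS A″) (h : B′ → FS B″) (g′ : A → FS A′) (h′ : B → FS B′) p →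
  lin (g ⊗₁ h) ((g′ ⊗₁ h′) p) ≋ ((λ a → lin g (g′ a)) ⊗₁ (λ b → lin h (h′ b))) p
lin-⊗₁ g h g′ h′ (a , b) = lin-⊗ g h (g′ a) (h′ b)

-- Inserting `lin M` after `lin G`, the identity, into both tensor factors turns `G-ΔF` into a
-- formula for Δ itself.
Δ-M : ∀ x → Δ x ≋ lin (M ⊗₁ M) (lin D (lin G x))
Δ-M x = begin
  lin ΔF x
    ≈⟨ lin-congˡ x (λ u → begin
         ΔF u
           ≈⟨ lin-id (ΔF u) ⟨
         lin bas (ΔF u)
           ≈⟨ lin-congˡ (ΔF u) (λ p → ≋.trans (lin-⊗₁ M M G G p)
                (≋.trans (⊗-cong (lin-M-G (proj₁ p)) (lin-M-G (proj₂ p))) (bas-⊗ _ _))) ⟨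
         lin (λ p → lin (M ⊗₁ M) ((G ⊗₁ G) p)) (ΔF u)
           ≈⟨ lin-lin (M ⊗₁ M) (G ⊗₁ G) (ΔF u) ⟨
         lin (M ⊗₁ M) (lin (G ⊗₁ G) (ΔF u))
           ≈⟨ lin-congʳ (M ⊗₁ M) (G-ΔF u) ⟩
         lin (M ⊗₁ M) (lin D (G u)) ∎) ⟩
  lin (λ u → lin (M ⊗₁ M) (lin D (G u))) x
    ≈⟨ lin-lin (M ⊗₁ M) (λ u → lin D (G u)) x ⟨
  lin (M ⊗₁ M) (lin (λ u → lin D (G u)) x)
    ≈⟨ lin-congʳ (M ⊗₁ M) (lin-lin D G x) ⟨
  lin (M ⊗₁ M) (lin D (lin G x)) ∎
  where open ≋-Reasoning

-- The grading

Homogeneous : ℕ → Set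
Homogeneous k = Σ Perm (λ u → T (inSᵏ k u))

monomial : ∀ k → Homogeneous k → SSym
monomial k i = M (proj₁ i)

lin-G-monomial : ∀ k (c : FS (Homogeneous k)) → lin G (lin (monomial k) c) ≋ lin (bas ∘ proj₁) c
lin-G-monomial k c = ≋.trans (lin-lin G (monomial k) c) (lin-congˡ c (λ i → lin-G-M (proj₁ i)))

component : ∀ k → Perm → FS (Homogeneous k)
component k u with T? (inSᵏ k u)
... | yes t = bas (u , t)
... | no  _ = []

linℚ-component : ∀ k (f : Perm → ℚ) u → linℚ (f ∘ proj₁) (component k u) ≡ ⟦ inSᵏ k u ⟧ ℚ.* f u
linℚ-component k f u with T? (inSᵏ k u)
... | yes t = trans (linℚ-bas {A = Homogeneous k} (f ∘ proj₁) (u , t))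
                    (sym (trans (cong (ℚ._* f u) (⟦⟧-true t)) (ℚ.*-identityˡ (f u))))
... | no ¬t = sym (*-vanishˡ (f u) (⟦⟧-false ¬t))

maxDegree : FS Perm → ℕ
maxDegree []            = 0
maxDegree ((_ , u) ∷ c) = length (dec u) ⊔ maxDegree c

degree≤max : ∀ {p} c → p ∈ c → length (dec (proj₂ p)) ≤ maxDegree c
degree≤max ((_ , u) ∷ c) (here refl) = ℕ.m≤m⊔n (length (dec u)) (maxDegree c)
degree≤max ((_ , u) ∷ c) (there p∈)  = ℕ.≤-trans (degree≤max c p∈) (ℕ.m≤n⊔m (length (dec u)) (maxDegree c))

SSym-spans : ∀ x → Σ ℕ λ N → Σ (Fin N → SSym) λ xs → (∀ k → SSymᵏ (toℕ k) (xs k)) × x ≈ sumV N xs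
SSym-spans x = N , xs , (λ k → lin (component (toℕ k)) c , λ _ → refl) , ≋⇒Eqv perm-≟ x≋
  where
  c : FS Perm
  c = lin G x
  N : ℕ
  -- One more than the maximum, so that the top degree is an element of `Fin N`.
  N = suc (maxDegree c)
  xs : Fin N → SSym
  xs k = lin (monomial (toℕ k)) (lin (component (toℕ k)) c)
  x≋ : x ≋ sumV N xs
  x≋ .eval f = begin
    linℚ f x
      ≡⟨ lin-M-lin-G x .eval f ⟨
    linℚ f (lin M c)
      ≡⟨ linℚ-lin f M c ⟩
    linℚ m c
      ≡⟨ linℚ-cong-∈ c (λ {p} p∈ → pick (proj₂ p) (s≤s (degree≤max c p∈))) ⟨
    linℚ (λ u → ∑Fin N (λ k → ⟦ inSᵏ (toℕ k) u ⟧ ℚ.* m u)) c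
      ≡⟨ ∑Fin-linℚ N (λ k u → ⟦ inSᵏ (toℕ k) u ⟧ ℚ.* m u) c ⟨
    ∑Fin N (λ k → linℚ (λ u → ⟦ inSᵏ (toℕ k) u ⟧ ℚ.* m u) c)
      ≡⟨ ∑Fin-cong N (λ k → trans (linℚ-lin f (monomial (toℕ k)) (lin (component (toℕ k)) c))
           (trans (linℚ-lin _ (component (toℕ k)) c) (linℚ-cong c (linℚ-component (toℕ k) m)))) ⟨
    ∑Fin N (λ k → linℚ f (xs k))
      ≡⟨ linℚ-sumV f N xs ⟨
    linℚ f (sumV N xs) ∎
    where
    open ≡-Reasoning
    m : Perm → ℚ
    m u = linℚ f (M u)
    -- The number of factors of u is the only degree containing u, so a single summand is nonzero.
    pick : ∀ u → length (dec u) < N → ∑Fin N (λ k → ⟦ inSᵏ (toℕ k) u ⟧ ℚ.* m u) ≡ m u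
    pick u l = trans (∑Fin-single (fromℕ< l) _ (λ k ne → *-vanishˡ (m u) (⟦⟧-false (λ t →
        ne (toℕ-injective (trans (sym (length-dec {toℕ k} {u} t)) (sym (toℕ-fromℕ< l))))))))
      (trans (cong (λ k → ⟦ inSᵏ k u ⟧ ℚ.* m u) (toℕ-fromℕ< l))
        (trans (cong (ℚ._* m u) (⟦⟧-true (inSᵏ-dec u))) (ℚ.*-identityˡ (m u))))

-- The functional f ∘ π_k, where π_k is the projection onto (𝔖Sym)^k.
degreePart : ℕ → (Perm → ℚ) → Perm → ℚ
degreePart k f u = linℚ (λ v → ⟦ inSᵏ k v ⟧ ℚ.* linℚ f (M v)) (G u)

-- In monomial coordinates `x` involves only permutations of degree j, on which the indicator of
-- degree k is constant.
linℚ-degreePart : ∀ j x k f → SSymᵏ j x → linℚ (degreePart k f) x ≡ ⟦ does (j ℕ.≟ k) ⟧ ℚ.* linℚ f x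
linℚ-degreePart j x k f (c , e) = begin
  linℚ (degreePart k f) x
    ≡⟨ trans (sym (linℚ-lin h G x)) (lin-congʳ G x≋ .eval h) ⟩
  linℚ h (lin G (lin (monomial j) c))
    ≡⟨ trans (lin-G-monomial j c .eval h) (linℚ-lin h (bas ∘ proj₁) c) ⟩
  linℚ (λ i → linℚ h (bas (proj₁ i))) c
    ≡⟨ linℚ-cong c (λ i → trans (linℚ-bas h (proj₁ i)) (cong (ℚ._* linℚ f (monomial j i)) (indicator i (j ℕ.≟ k)))) ⟩
  linℚ (λ i → ⟦ does (j ℕ.≟ k) ⟧ ℚ.* linℚ f (monomial j i)) c
    ≡⟨ linℚ-*ˡ ⟦ does (j ℕ.≟ k) ⟧ (λ i → linℚ f (monomial j i)) c ⟩
  ⟦ does (j ℕ.≟ k) ⟧ ℚ.* linℚ (λ i → linℚ f (monomial j i)) c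
    ≡⟨ cong (⟦ does (j ℕ.≟ k) ⟧ ℚ.*_) (trans (x≋ .eval f) (linℚ-lin f (monomial j) c)) ⟨
  ⟦ does (j ℕ.≟ k) ⟧ ℚ.* linℚ f x ∎
  where
  open ≡-Reasoning
  h : Perm → ℚ
  h v = ⟦ inSᵏ k v ⟧ ℚ.* linℚ f (M v)
  x≋ : x ≋ lin (monomial j) c
  x≋ = Eqv⇒≋ perm-≟ x (lin (monomial j) c) e
  indicator : (i : Homogeneous j) → (d : Dec (j ≡ k)) → ⟦ inSᵏ k (proj₁ i) ⟧ ≡ ⟦ does d ⟧
  indicator (u , t) (yes refl) = ⟦⟧-true t
  indicator (u , t) (no ne)    = ⟦⟧-false (λ t′ → ne (inSᵏ-unique {j} {k} {u} t t′))

-- Evaluating f after the projection to degree k on the vanishing sum isolates the value of f on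
-- `xs k`.
SSym-independent : ∀ N (xs : Fin N → SSym) → (∀ k → SSymᵏ (toℕ k) (xs k)) → sumV N xs ≈ [] → ∀ k → xs k ≈ []
SSym-independent N xs homogeneous e k = ≋⇒Eqv perm-≟ xₖ≋0
  where
  xₖ≋0 : xs k ≋ []
  xₖ≋0 .eval f = begin
    linℚ f (xs k)
      ≡⟨ trans (cong (λ b → ⟦ b ⟧ ℚ.* linℚ f (xs k)) (dec-true (toℕ k ℕ.≟ toℕ k) refl))
               (ℚ.*-identityˡ (linℚ f (xs k))) ⟨
    term k
      ≡⟨ ∑Fin-single k term (λ i ne → *-vanishˡ (linℚ f (xs i))
           (cong ⟦_⟧ (dec-false (toℕ i ℕ.≟ toℕ k) (ne ∘ toℕ-injective)))) ⟨
    ∑Fin N term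
      ≡⟨ ∑Fin-cong N (λ i → linℚ-degreePart (toℕ i) (xs i) (toℕ k) f (homogeneous i)) ⟨
    ∑Fin N (λ i → linℚ (degreePart (toℕ k) f) (xs i))
      ≡⟨ linℚ-sumV (degreePart (toℕ k) f) N xs ⟨
    linℚ (degreePart (toℕ k) f) (sumV N xs)
      ≡⟨ Eqv⇒≋ perm-≟ (sumV N xs) [] e .eval (degreePart (toℕ k) f) ⟩
    0ℚ ∎
    where
    open ≡-Reasoning
    term : Fin N → ℚ
    term i = ⟦ does (toℕ i ℕ.≟ toℕ k) ⟧ ℚ.* linℚ f (xs i)

M-homogeneous : ∀ w → SSymᵏ (length w) (M (comp w))
M-homogeneous w =
  bas (comp w , inSᵏ-comp w) , ≋⇒Eqv perm-≟ (≋.sym (lin-bas (monomial (length w)) (comp w , inSᵏ-comp w)))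

-- `Δ-M` cuts a factorisation into k factors into a prefix and a suffix, whose lengths are the two
-- degrees and add up to k.
Δ-graded : ∀ k x → SSymᵏ k x → SSym⊗ᵏ k (Δ x)
Δ-graded k x (c , e) = lin pieces c , ≋⇒Eqv (×-dec perm-≟ perm-≟) (begin
  Δ x
    ≈⟨ Δ-M x ⟩
  lin (M ⊗₁ M) (lin D (lin G x))
    ≈⟨ lin-congʳ (M ⊗₁ M) (lin-congʳ D
         (≋.trans (lin-congʳ G (Eqv⇒≋ perm-≟ x (lin (monomial k) c) e)) (lin-G-monomial k c))) ⟩
  lin (M ⊗₁ M) (lin D (lin {A = Homogeneous k} (bas ∘ proj₁) c))
    ≈⟨ lin-congʳ (M ⊗₁ M) (≋.trans (lin-lin {A = Homogeneous k} D (bas ∘ proj₁) c)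
         (lin-congˡ c (λ i → lin-bas D (proj₁ i)))) ⟩
  lin (M ⊗₁ M) (lin (λ i → D (proj₁ i)) c)
    ≈⟨ lin-lin (M ⊗₁ M) (λ i → D (proj₁ i)) c ⟩
  lin (λ i → lin (M ⊗₁ M) (D (proj₁ i))) c
    ≈⟨ lin-congˡ c pieces-D ⟨
  lin (λ i → lin product (pieces i)) c
    ≈⟨ lin-lin product pieces c ⟨
  lin product (lin pieces c) ∎)
  where
  open ≋-Reasoning
  I : Set
  I = Σ ℕ λ i → Σ ℕ λ j → (i + j ≡ k) × Σ SSym (SSymᵏ i) × Σ SSym (SSymᵏ j)
  product : I → FS (Perm × Perm)
  product t = proj₁ (proj₁ (proj₂ (proj₂ (proj₂ t)))) ⊗ proj₁ (proj₂ (proj₂ (proj₂ (proj₂ t))))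
  piece : Homogeneous k → ℕ → I
  piece (u , t) i = length (take i w) , length (drop i w) ,
    trans (sym (List.length-++ (take i w))) (trans (cong length (List.take++drop≡id i w)) (length-dec {k} {u} t)) ,
    (M (comp (take i w)) , M-homogeneous (take i w)) , (M (comp (drop i w)) , M-homogeneous (drop i w))
    where
    w : List Connected
    w = dec u
  pieces : Homogeneous k → FS I
  pieces h = map (λ i → (1ℚ , piece h i)) (upTo (suc (length (dec (proj₁ h)))))
  pieces-D : ∀ h → lin product (pieces h) ≋ lin (M ⊗₁ M) (D (proj₁ h))
  pieces-D h .eval f = trans (linℚ-lin f product (pieces h))
    (trans (linℚ-unweighted (λ t → linℚ f (product t)) (piece h) (upTo (suc (length (dec (proj₁ h))))))
    (trans (sym (linℚ-unweighted (λ p → linℚ f ((M ⊗₁ M) p))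
              (λ i → (comp (take i (dec (proj₁ h))) , comp (drop i (dec (proj₁ h))))) (upTo (suc (length (dec (proj₁ h)))))))
      (sym (linℚ-lin f (M ⊗₁ M) (D (proj₁ h))))))

εF-positive : ∀ u → 1 ≤ size u → εF u ≡ 0ℚ
εF-positive u l with size u
εF-positive u (s≤s _) | suc _ = refl

-- M_u involves only permutations of the same size as u, which is positive in positive degree.
ε-graded : ∀ k x → SSymᵏ (suc k) x → ε x ≡ 0ℚ
ε-graded k x (c , e) = begin
  linℚ εF x                                ≡⟨ Eqv⇒≋ perm-≟ x (lin (monomial (suc k)) c) e .eval εF ⟩
  linℚ εF (lin (monomial (suc k)) c)                 ≡⟨ linℚ-lin εF (monomial (suc k)) c ⟩
  linℚ (λ i → linℚ εF (monomial (suc k) i)) c      ≡⟨ linℚ-cong c vanish ⟩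
  linℚ (λ _ → 0ℚ) c                        ≡⟨ linℚ-zero c ⟩
  0ℚ                                       ∎
  where
  open ≡-Reasoning
  vanish : (i : Homogeneous (suc k)) → linℚ εF (monomial (suc k) i) ≡ 0ℚ
  vanish (u , t) = trans (linℚ-M εF u) (∑-zero (allPerms (size u)) (λ {v} v∈ →
    *-vanishʳ (ζ u v) (*-vanishʳ (μ u v) (εF-positive v
      (subst (1 ≤_) (sym (∈-allPerms⁻ {size u} v∈)) (proj₁ (inSᵏ⁻ {k} {u} t)))))))

-- Cofreeness

open Cofree Connected connected-≟

-- Given on F_u through its monomial coordinates; on the monomial basis it is simply M_v ↦ `dec v`,
-- see `φ-M`.
φ : Perm → QV
φ u = lin (bas ∘ dec) (G u)

ψ : List Connected → SSym
ψ w = M (comp w)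

ψ∘φ : ∀ x → lin ψ (lin φ x) ≋ x
ψ∘φ x = begin
  lin ψ (lin φ x)             ≈⟨ lin-lin ψ φ x ⟩
  lin (λ u → lin ψ (φ u)) x   ≈⟨ lin-congˡ x (λ u → ≋.trans (lin-lin ψ (bas ∘ dec) (G u)) (lin-congˡ (G u) on-M)) ⟩
  lin (λ u → lin M (G u)) x   ≈⟨ lin-lin M G x ⟨
  lin M (lin G x)             ≈⟨ lin-M-lin-G x ⟩
  x                           ∎
  where
  open ≋-Reasoning
  on-M : ∀ v → lin ψ (bas (dec v)) ≋ M v
  on-M v = ≋.trans (lin-bas ψ (dec v)) (≋.reflexive (cong M (comp-dec v)))

φ-M : ∀ u → lin φ (M u) ≋ bas (dec u)
φ-M u = begin
  lin φ (M u)                              ≈⟨ lin-lin (bas ∘ dec) G (M u) ⟨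
  lin (bas ∘ dec) (lin G (M u))            ≈⟨ lin-congʳ (bas ∘ dec) (lin-G-M u) ⟩
  lin (bas ∘ dec) (bas u)                  ≈⟨ lin-bas (bas ∘ dec) u ⟩
  bas (dec u)                              ∎
  where open ≋-Reasoning

φ∘ψ : ∀ y → lin φ (lin ψ y) ≋ y
φ∘ψ y = begin
  lin φ (lin ψ y)             ≈⟨ lin-lin φ ψ y ⟩
  lin (λ w → lin φ (ψ w)) y   ≈⟨ lin-congˡ y (λ w → ≋.trans (φ-M (comp w)) (≋.reflexive (cong bas (dec-comp w)))) ⟩
  lin bas y                   ≈⟨ lin-id y ⟩
  y                           ∎
  where open ≋-Reasoning

δQ : List Connected → FS (List Connected × List Connected)
δQ w = map (λ i → (1ℚ , (take i w , drop i w))) (upTo (suc (length w)))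

dec-D : ∀ u → lin ((bas ∘ dec) ⊗₁ (bas ∘ dec)) (D u) ≋ δQ (dec u)
dec-D u .eval f = begin
  linℚ f (lin ((bas ∘ dec) ⊗₁ (bas ∘ dec)) (D u))
    ≡⟨ linℚ-lin f ((bas ∘ dec) ⊗₁ (bas ∘ dec)) (D u) ⟩
  linℚ (λ p → linℚ f (((bas ∘ dec) ⊗₁ (bas ∘ dec)) p)) (D u)
    ≡⟨ linℚ-cong (D u) (λ (a , b) → trans (bas-⊗ (dec a) (dec b) .eval f) (linℚ-bas f (dec a , dec b))) ⟩
  linℚ (λ (a , b) → f (dec a , dec b)) (D u)
    ≡⟨ linℚ-unweighted (λ (a , b) → f (dec a , dec b)) (λ i → (comp (take i w) , comp (drop i w))) cuts ⟩
  ∑ cuts (λ i → f (dec (comp (take i w)) , dec (comp (drop i w))))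
    ≡⟨ ∑-cong cuts (λ i → cong f (cong₂ _,_ (dec-comp (take i w)) (dec-comp (drop i w)))) ⟩
  ∑ cuts (λ i → f (take i w , drop i w))
    ≡⟨ linℚ-unweighted f (λ i → (take i w , drop i w)) cuts ⟨
  linℚ f (δQ w) ∎
  where
  open ≡-Reasoning
  w : List Connected
  w = dec u
  cuts : List ℕ
  cuts = upTo (suc (length w))

-- By linearity it suffices to treat F_u: `dec` turns `D` into deconcatenation of words, and `G-ΔF`
-- carries this back to Δ F_u.
φ-coproduct : ∀ x → ΔQ (lin φ x) ≋ lin (φ ⊗₁ φ) (Δ x)
φ-coproduct x = begin
  lin δQ (lin φ x)
    ≈⟨ lin-lin δQ φ x ⟩
  lin (λ u → lin δQ (φ u)) x
    ≈⟨ lin-congˡ x on-F ⟩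
  lin (λ u → lin (φ ⊗₁ φ) (ΔF u)) x
    ≈⟨ lin-lin (φ ⊗₁ φ) ΔF x ⟨
  lin (φ ⊗₁ φ) (lin ΔF x) ∎
  where
  open ≋-Reasoning
  dd : Perm × Perm → FS (List Connected × List Connected)
  dd = (bas ∘ dec) ⊗₁ (bas ∘ dec)
  on-F : ∀ u → lin δQ (φ u) ≋ lin (φ ⊗₁ φ) (ΔF u)
  on-F u = begin
    lin δQ (lin (bas ∘ dec) (G u))         ≈⟨ lin-lin δQ (bas ∘ dec) (G u) ⟩
    lin (λ v → lin δQ (bas (dec v))) (G u) ≈⟨ lin-congˡ (G u) (λ v → ≋.trans (lin-bas δQ (dec v)) (≋.sym (dec-D v))) ⟩
    lin (λ v → lin dd (D v)) (G u)         ≈⟨ lin-lin dd D (G u) ⟨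
    lin dd (lin D (G u))                   ≈⟨ lin-congʳ dd (G-ΔF u) ⟨
    lin dd (lin (G ⊗₁ G) (ΔF u))           ≈⟨ lin-lin dd (G ⊗₁ G) (ΔF u) ⟩
    lin (λ p → lin dd ((G ⊗₁ G) p)) (ΔF u) ≈⟨ lin-congˡ (ΔF u) (lin-⊗₁ (bas ∘ dec) (bas ∘ dec) G G) ⟩
    lin (φ ⊗₁ φ) (ΔF u)                    ∎

φ-counit : ∀ x → εQ (lin φ x) ≡ ε x
φ-counit x = trans (linℚ-lin emptyQ φ x) (linℚ-cong x on-F)
  where
  open ≡-Reasoning
  emptyQ : List Connected → ℚ
  emptyQ w = if length w ℕ.≡ᵇ 0 then 1ℚ else 0ℚ
  emptyQ-dec : ∀ u → emptyQ (dec u) ≡ εF u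
  emptyQ-dec u = begin
    emptyQ (dec u)        ≡⟨ cases (dec u) ⟩
    εF (comp (dec u))     ≡⟨ cong εF (comp-dec u) ⟩
    εF u                  ∎
    where
    cases : ∀ w → emptyQ w ≡ εF (comp w)
    cases []      = refl
    cases (b ∷ w) = sym (εF-positive (comp (b ∷ w)) (size-comp b w))
  G-εF : ∀ u → linℚ εF (G u) ≡ εF u
  G-εF u with size u ℕ.≟ 0
  -- For the empty permutation the sum has the single term 1 and both sides compute.
  ... | yes e with refl ← size-0 u e = refl
  ... | no ne = trans (linℚ-G εF u) (trans
    (∑-zero (allPerms (size u)) (λ {v} v∈ → *-vanishʳ (ζ u v)
      (εF-positive v (subst (1 ≤_) (sym (∈-allPerms⁻ {size u} v∈)) (ℕ.n≢0⇒n>0 ne)))))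
    (sym (εF-positive u (ℕ.n≢0⇒n>0 ne))))
  on-F : ∀ u → linℚ emptyQ (φ u) ≡ εF u
  on-F u = begin
    linℚ emptyQ (lin (bas ∘ dec) (G u))
      ≡⟨ linℚ-lin emptyQ (bas ∘ dec) (G u) ⟩
    linℚ (λ v → linℚ emptyQ (bas (dec v))) (G u)
      ≡⟨ linℚ-cong (G u) (λ v → trans (linℚ-bas emptyQ (dec v)) (emptyQ-dec v)) ⟩
    linℚ εF (G u)
      ≡⟨ G-εF u ⟩
    εF u ∎

Word : ℕ → Set
Word k = Σ (List Connected) (λ w → length w ≡ k)

φ-graded : ∀ k x → SSymᵏ k x → Qᵏ k (lin φ x)
φ-graded k x (c , e) = lin (bas ∘ letters) c , ≋⇒Eqv decW (begin
  lin φ x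
    ≈⟨ lin-congʳ φ (Eqv⇒≋ perm-≟ x (lin (monomial k) c) e) ⟩
  lin φ (lin (monomial k) c)
    ≈⟨ lin-lin φ (monomial k) c ⟩
  lin (λ i → lin φ (monomial k i)) c
    ≈⟨ lin-congˡ c (λ i → ≋.trans (φ-M (proj₁ i)) (≋.sym (lin-bas (bas ∘ proj₁) (letters i)))) ⟩
  lin (λ i → lin (bas ∘ proj₁) (bas (letters i))) c
    ≈⟨ lin-lin (bas ∘ proj₁) (bas ∘ letters) c ⟨
  lin (bas ∘ proj₁) (lin (bas ∘ letters) c) ∎)
  where
  open ≋-Reasoning
  letters : Homogeneous k → Word k
  letters (u , t) = dec u , length-dec {k} {u} t

ψ-graded : ∀ k y → Qᵏ k y → SSymᵏ k (lin ψ y)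
ψ-graded k y (c , e) = lin (bas ∘ product) c , ≋⇒Eqv perm-≟ (begin
  lin ψ y
    ≈⟨ lin-congʳ ψ (Eqv⇒≋ decW y (lin (bas ∘ proj₁) c) e) ⟩
  lin ψ (lin (bas ∘ proj₁) c)
    ≈⟨ lin-lin ψ (bas ∘ proj₁) c ⟩
  lin (λ i → lin ψ (bas (proj₁ i))) c
    ≈⟨ lin-congˡ c (λ i → ≋.trans (lin-bas ψ (proj₁ i)) (≋.sym (lin-bas (monomial k) (product i)))) ⟩
  lin (λ i → lin (monomial k) (bas (product i))) c
    ≈⟨ lin-lin (monomial k) (bas ∘ product) c ⟨
  lin (monomial k) (lin (bas ∘ product) c) ∎)
  where
  open ≋-Reasoning
  product : Word k → Homogeneous k
  product (w , e) = comp w , subst (λ j → T (inSᵏ j (comp w))) e (inSᵏ-comp w)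

theorem3p1 : IsDecomposition SSymᵏ × IsCoalgebraGrading SSymᵏ SSym⊗ᵏ × IsCofree SSymᵏ
theorem3p1 =
  (SSym-spans , SSym-independent) ,
  (Δ-graded , ε-graded) ,
  Connected , connected-≟ , φ , ψ ,
  (λ x → ≋⇒Eqv perm-≟ (ψ∘φ x)) ,
  (λ y → ≋⇒Eqv decW (φ∘ψ y)) ,
  (λ x → ≋⇒Eqv (×-dec decW decW) (φ-coproduct x)) ,
  φ-counit , φ-graded , ψ-graded
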